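{- Let $G_1$ and $G_2$ be finite groups such that $G_1$ admits a DRR (respectively, a GRR) and $G_2$ is not DRR-detecting (respectively, not GRR-detecting). Then $G_1 \times G_2$ is not DRR-detecting (respectively, not GRR-detecting).
   Context: All groups and graphs are finite. For a subset $S$ of a group $G$, the Cayley digraph $\mathrm{Cay}(G,S)$ has vertex set $G$ and a directed edge from $g_1$ to $g_2$ iff $g_2 = s g_1$ for some $s \in S$; if $S$ is inverse-closed it is a graph (Cayley graph). $\mathrm{Aut}(G,S) = \{\varphi \in \mathrm{Aut}(G) : \varphi(S) = S\}$. A digraph $\Gamma$ is a DRR of $G$ if $\mathrm{Aut}(\Gamma) \cong G$ and acts regularly on the vertices; a GRR is a DRR that is a graph. $G$ is GRR-detecting if for every inverse-closed $S \subseteq G$, $\mathrm{Aut}(G,S)=\{1\}$ implies $\mathrm{Cay}(G,S)$ is a GRR; $G$ is DRR-detecting if for every $S \subseteq G$, $\mathrm{Aut}(G,S)=\{1\}$ implies $\mathrm{Cay}(G,S)$ is a DRR. -}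

module Defs where

open import Data.Nat using (ℕ; _*_)
open import Data.Fin using (Fin)
open import Data.Fin.Properties using (*↔×)
open import Data.Bool using (Bool; true)
open import Data.Product using (Σ; ∃; _×_; _,_; proj₁; proj₂)
open import Function.Bundles using (_↔_; _⇔_)
open import Function.Construct.Composition using (_↔-∘_)
open import Function.Construct.Symmetry using (↔-sym)
open import Data.Product.Function.NonDependent.Propositional using (_×-↔_)
open import Algebra.Structures using (IsGroup; IsMonoid; IsSemigroup; IsMagma)
open import Relation.Nullary using (¬_)
open import Relation.Binary.PropositionalEquality
  using (_≡_; refl; cong; cong₂; isEquivalence)

record FinGroup : Set₁ where
  infixl 7 _∙_
  field
    Carrier : Set
    _∙_     : Carrier → Carrier → Carrier
    ε       : Carrier
    _⁻¹     : Carrier → Carrier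
    isGroup : IsGroup _≡_ _∙_ ε _⁻¹
    size    : ℕ
    enum    : Carrier ↔ Fin size

open FinGroup public using (Carrier)

_×G_ : FinGroup → FinGroup → FinGroup
G₁ ×G G₂ = record
  { Carrier = C₁ × C₂
  ; _∙_     = λ x y → (proj₁ x ∙₁ proj₁ y , proj₂ x ∙₂ proj₂ y)
  ; ε       = (ε₁ , ε₂)
  ; _⁻¹     = λ x → ((proj₁ x) ⁻¹₁ , (proj₂ x) ⁻¹₂)
  ; isGroup = record
    { isMonoid = record
      { isSemigroup = record
        { isMagma = record
          { isEquivalence = isEquivalence
          ; ∙-cong = λ { refl refl → refl } }
        ; assoc = λ x y z → cong₂ _,_ (G1.assoc (proj₁ x) (proj₁ y) (proj₁ z))
                                        (G2.assoc (proj₂ x) (proj₂ y) (proj₂ z)) }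
      ; identity = (λ x → cong₂ _,_ (proj₁ G1.identity (proj₁ x)) (proj₁ G2.identity (proj₂ x)))
                 , (λ x → cong₂ _,_ (proj₂ G1.identity (proj₁ x)) (proj₂ G2.identity (proj₂ x))) }
    ; inverse = (λ x → cong₂ _,_ (proj₁ G1.inverse (proj₁ x)) (proj₁ G2.inverse (proj₂ x)))
              , (λ x → cong₂ _,_ (proj₂ G1.inverse (proj₁ x)) (proj₂ G2.inverse (proj₂ x)))
    ; ⁻¹-cong = λ { refl → refl } }
  ; size    = FinGroup.size G₁ * FinGroup.size G₂
  ; enum    = ↔-sym *↔× ↔-∘ (FinGroup.enum G₁ ×-↔ FinGroup.enum G₂)
  }
  where
  open FinGroup G₁ renaming (Carrier to C₁; _∙_ to _∙₁_; ε to ε₁; _⁻¹ to _⁻¹₁)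
  open FinGroup G₂ renaming (Carrier to C₂; _∙_ to _∙₂_; ε to ε₂; _⁻¹ to _⁻¹₂)
  module G1 = IsGroup (FinGroup.isGroup G₁)
  module G2 = IsGroup (FinGroup.isGroup G₂)

IsDigraphAut : {V : Set} → (V → V → Set) → (V → V) → Set
IsDigraphAut {V} E σ =
  (Σ (V → V) λ τ → (∀ x → τ (σ x) ≡ x) × (∀ x → σ (τ x) ≡ x))
  × (∀ u v → E u v ⇔ E (σ u) (σ v))

-- The digraph (V , E) is a DRR of G: Aut(V , E) ≅ G and Aut(V , E)
-- acts regularly on V.  Concretely: there is a map ρ from G into
-- Aut(V , E) which is a group homomorphism (for composition), injective
-- and surjective onto Aut(V , E), and the action of Aut(V , E) ≅ ρ(G)
-- on V is transitive with trivial point stabilisers.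
IsDRR : (G : FinGroup) (V : Set) → (V → V → Set) → Set
IsDRR G V E =
  Σ (Carrier G → V → V) λ ρ →
    (∀ g → IsDigraphAut E (ρ g))
  × (∀ g h x → ρ (g ∙ h) x ≡ ρ g (ρ h x))
  × (∀ g h → (∀ x → ρ g x ≡ ρ h x) → g ≡ h)
  × (∀ σ → IsDigraphAut E σ → Σ (Carrier G) λ g → ∀ x → σ x ≡ ρ g x)
  × (∀ u v → Σ (Carrier G) λ g → ρ g u ≡ v)
  × (∀ g u → ρ g u ≡ u → g ≡ ε)
  where open FinGroup G hiding (Carrier)

IsGraph : {V : Set} → (V → V → Set) → Set
IsGraph {V} E = ∀ u v → E u v → E v u

IsGRR : (G : FinGroup) (V : Set) → (V → V → Set) → Set
IsGRR G V E = IsDRR G V E × IsGraph E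

AdmitsDRR : FinGroup → Set
AdmitsDRR G = Σ ℕ λ m → Σ (Fin m → Fin m → Bool) λ E →
  IsDRR G (Fin m) (λ u v → E u v ≡ true)

AdmitsGRR : FinGroup → Set
AdmitsGRR G = Σ ℕ λ m → Σ (Fin m → Fin m → Bool) λ E →
  IsGRR G (Fin m) (λ u v → E u v ≡ true)

Cay : (G : FinGroup) → (Carrier G → Bool) → Carrier G → Carrier G → Set
Cay G S g₁ g₂ = Σ (Carrier G) λ s → (S s ≡ true) × (g₂ ≡ s ∙ g₁)
  where open FinGroup G hiding (Carrier)

InverseClosed : (G : FinGroup) → (Carrier G → Bool) → Set
InverseClosed G S = ∀ x → S x ≡ true → S (x ⁻¹) ≡ true
  where open FinGroup G hiding (Carrier)

IsGroupAut : (G : FinGroup) → (Carrier G → Carrier G) → Set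
IsGroupAut G φ =
  (∀ x y → φ (x ∙ y) ≡ φ x ∙ φ y)
  × (Σ (Carrier G → Carrier G) λ ψ → (∀ x → ψ (φ x) ≡ x) × (∀ x → φ (ψ x) ≡ x))
  where open FinGroup G hiding (Carrier)

AutGSTrivial : (G : FinGroup) → (Carrier G → Bool) → Set
AutGSTrivial G S =
  ∀ φ → IsGroupAut G φ → (∀ x → S (φ x) ≡ S x) → ∀ x → φ x ≡ x

DRRDetecting : FinGroup → Set
DRRDetecting G = ∀ (S : Carrier G → Bool) →
  AutGSTrivial G S → IsDRR G (Carrier G) (Cay G S)

GRRDetecting : FinGroup → Set
GRRDetecting G = ∀ (S : Carrier G → Bool) → InverseClosed G S →
  AutGSTrivial G S → IsGRR G (Carrier G) (Cay G S)

{-# OPTIONS --safe #-}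

-- Let Cay(G₁ , S₁) be a DRR and let Aut(G₂ , S₂) = 1, and consider the
-- Cartesian product set S = S₁ × 1 ∪ 1 × S₂.  Any automorphism of
-- Cay(G₂ , S₂) extends to Cay(G₁ × G₂ , S), so the point is to get
-- Aut(G₁ × G₂ , S) = 1.  If φ preserves S, then S₁ lies in the union of
-- P = {a : φ(a , 1) ∈ G₁ × 1} and Q = {a : φ(a , 1) ∈ 1 × G₂}, two commuting
-- subgroups with trivial intersection; similarly for S₂.  Call S_i
-- decomposable if it is so covered by proper subgroups.  When neither S_i is
-- decomposable, φ preserves both factors, hence is trivial, or it swaps them,
-- and then Cay(G₂ , S₂) ≅ Cay(G₁ , S₁) is a DRR as well.
--
-- Replacing S_i by its complement changes no automorphism group.  If S and its
-- complement are both decomposable, by P , Q and P′ , Q′, then G is the union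
-- of these four subgroups, and Aut(G , S) ≠ 1.  Indeed, if one of the subgroups
-- is trivial, G is a Klein four-group with an automorphism preserving S; if,
-- say, P and P′ share u ≠ 1, then u is a central involution and multiplication
-- by u off a subgroup of index 2 preserves S, or again G is a Klein four-group;
-- if all intersections are trivial, G is abelian and inversion preserves S, so
-- that G has exponent 2, which is incompatible with the four subgroups.

module Submission where

open import Defs
open import Level using (0ℓ)
open import Algebra.Bundles using (Group)
open import Data.Bool using (Bool; true; false; not; _xor_)
open import Data.Bool.Properties using (not-involutive; not-injective; ⇔→≡)
open import Data.Empty using (⊥; ⊥-elim)
open import Data.Fin using (zero)
import Data.Fin.Properties as Fin
open import Data.Nat using (zero; suc)
open import Data.Product using (Σ; ∃; _×_; _,_; proj₁; proj₂)
open import Data.Sum using (_⊎_; inj₁; inj₂; [_,_]′; swap)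
open import Function using (_∘_; id)
open import Function.Bundles using (Inverse; Equivalence; mk⇔; _⇔_)
open import Function.Properties.Inverse using (↔⇒↣)
open import Relation.Binary using (DecidableEquality)
open import Relation.Binary.PropositionalEquality
  using (_≡_; _≢_; refl; sym; trans; cong; cong₂; subst; module ≡-Reasoning)
open import Relation.Nullary using (¬_; Dec; yes; no; contradiction; _×-dec_; _⊎-dec_; ¬?)
open import Relation.Nullary.Decidable using (via-injection; map′; decidable-stable)
open import Relation.Unary using (Pred; Decidable)

-- Finite groups, subgroups and decomposable sets.

module FiniteGroup (G : FinGroup) where
  open FinGroup G using (size; enum)

  group : Group 0ℓ 0ℓ
  group = record { isGroup = FinGroup.isGroup G }

  open Group group public
    using (_∙_; ε; _⁻¹; _\\_; _//_; assoc; identityˡ; identityʳ; inverseˡ; inverseʳ)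
  open import Algebra.Properties.Group group public

  C : Set
  C = Carrier G

  infix 4 _≟_
  _≟_ : DecidableEquality C
  _≟_ = via-injection (↔⇒↣ enum) Fin._≟_

  search : {P : Pred C 0ℓ} → Decidable P → Dec (∃ P)
  search {P} P? = map′ (λ (i , p) → Inverse.from enum i , p)
    (λ (x , p) → Inverse.to enum x , subst P (sym (Inverse.strictlyInverseʳ enum x)) p)
    (Fin.any? (λ i → P? (Inverse.from enum i)))

  ⁻¹-≢ε : ∀ {x} → x ≢ ε → x ⁻¹ ≢ ε
  ⁻¹-≢ε x≢ε x⁻¹≡ε = x≢ε (⁻¹-injective (trans x⁻¹≡ε (sym ε⁻¹≈ε)))

  x∙y≡x⇒y≡ε : ∀ {x y} → x ∙ y ≡ x → y ≡ ε
  x∙y≡x⇒y≡ε {x} {y} = identityʳ-unique x y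

  -- Values at ε are ignored: they only decide about loops.
  AutTrivial : (C → Bool) → Set
  AutTrivial S = ∀ φ → IsGroupAut G φ → (∀ x → x ≢ ε → S (φ x) ≡ S x) → ∀ x → φ x ≡ x

  autTrivial-not : ∀ {S} → AutTrivial S → AutTrivial (not ∘ S)
  autTrivial-not t φ φ-aut φ-S = t φ φ-aut (λ x x≢ε → not-injective (φ-S x x≢ε))

  record Subgroup (P : Pred C 0ℓ) : Set where
    field
      mem? : Decidable P
      ε∈   : P ε
      ∙∈   : ∀ {x y} → P x → P y → P (x ∙ y)
      ⁻¹∈  : ∀ {x} → P x → P (x ⁻¹)

    cancelˡ∈ : ∀ {x y} → P x → P (x ∙ y) → P y
    cancelˡ∈ {x} {y} px pxy = subst P (\\-leftDividesʳ x y) (∙∈ (⁻¹∈ px) pxy)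

    cancelʳ∈ : ∀ {x y} → P y → P (x ∙ y) → P x
    cancelʳ∈ {x} {y} py pxy = subst P (//-rightDividesʳ y x) (∙∈ pxy (⁻¹∈ py))

  open Subgroup

  -- P and Q need not generate G: with Q = 1, this includes the sets
  -- contained in a proper subgroup.
  record ProperPair (P Q : Pred C 0ℓ) : Set where
    field
      subP     : Subgroup P
      subQ     : Subgroup Q
      commute  : ∀ {x y} → P x → Q y → x ∙ y ≡ y ∙ x
      disjoint : ∀ {x} → P x → Q x → x ≡ ε
      properP  : ∃ λ x → ¬ P x
      properQ  : ∃ λ x → ¬ Q x

  flip-pair : ∀ {P Q} → ProperPair P Q → ProperPair Q P
  flip-pair r = record
    { subP = subQ ; subQ = subP ; commute = λ x∈ y∈ → sym (commute y∈ x∈)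
    ; disjoint = λ x∈Q x∈P → disjoint x∈P x∈Q ; properP = properQ ; properQ = properP }
    where open ProperPair r

  Covers : (C → Bool) → (P Q : Pred C 0ℓ) → Set
  Covers S P Q = ∀ {x} → x ≢ ε → S x ≡ true → P x ⊎ Q x

  Decomposable : (C → Bool) → Set₁
  Decomposable S = ∃ λ P → ∃ λ Q → ProperPair P Q × Covers S P Q

  -- If `g` is outside `P` and `h` outside `Q`, a cover would force `g` into `Q` and `h` into `P`;
  -- wherever `g ∙ h` then lies, cancelling one factor contradicts the choice of the other.
  two-cover : ∀ {P Q : Pred C 0ℓ} → Subgroup P → Subgroup Q → ∃ (λ x → ¬ P x) → ∃ (λ x → ¬ Q x) →
    ¬ (∀ x → P x ⊎ Q x)
  two-cover sP sQ (g , g∉P) (h , h∉Q) cover with cover g | cover h | cover (g ∙ h)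
  ... | inj₁ g∈P | _        | _        = g∉P g∈P
  ... | inj₂ _   | inj₂ h∈Q | _        = h∉Q h∈Q
  ... | inj₂ _   | inj₁ h∈P | inj₁ gh∈ = g∉P (cancelʳ∈ sP h∈P gh∈)
  ... | inj₂ g∈Q | inj₁ _   | inj₂ gh∈ = h∉Q (cancelˡ∈ sQ g∈Q gh∈)

  -- Shears along a central involution, and the Klein four-group.

  module Shear {S : C → Bool} (autS : AutTrivial S) {K : Pred C 0ℓ} (sK : Subgroup K)
    {u : C} (u≢ε : u ≢ ε) (uu≡ε : u ∙ u ≡ ε) (u∈K : K u)
    (central : ∀ x → u ∙ x ≡ x ∙ u)
    (index₂ : ∀ {x y} → ¬ K x → ¬ K y → K (x ∙ y))
    (S-inv : ∀ {x} → ¬ K x → S (x ∙ u) ≡ S x) where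

    shear : C → C
    shear x with mem? sK x
    ... | yes _ = x
    ... | no  _ = x ∙ u

    shear-∈ : ∀ {x} → K x → shear x ≡ x
    shear-∈ {x} x∈ with mem? sK x
    ... | yes _  = refl
    ... | no  x∉ = contradiction x∈ x∉

    shear-∉ : ∀ {x} → ¬ K x → shear x ≡ x ∙ u
    shear-∉ {x} x∉ with mem? sK x
    ... | yes x∈ = contradiction x∈ x∉
    ... | no  _  = refl

    xuu≡x : ∀ x → x ∙ u ∙ u ≡ x
    xuu≡x x = trans (assoc x u u) (trans (cong (x ∙_) uu≡ε) (identityʳ x))

    xyu≡xuy : ∀ x y → x ∙ y ∙ u ≡ x ∙ u ∙ y
    xyu≡xuy x y = trans (assoc x y u) (trans (cong (x ∙_) (sym (central y))) (sym (assoc x u y)))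

    shear-involutive : ∀ x → shear (shear x) ≡ x
    shear-involutive x with mem? sK x
    ... | yes x∈ = shear-∈ x∈
    ... | no  x∉ = trans (shear-∉ (x∉ ∘ cancelʳ∈ sK u∈K)) (xuu≡x x)

    shear-∙ : ∀ x y → shear (x ∙ y) ≡ shear x ∙ shear y
    shear-∙ x y with mem? sK x | mem? sK y
    ... | yes x∈ | yes y∈ = shear-∈ (∙∈ sK x∈ y∈)
    ... | yes x∈ | no  y∉ = trans (shear-∉ (y∉ ∘ cancelˡ∈ sK x∈)) (assoc x y u)
    ... | no  x∉ | yes y∈ = trans (shear-∉ (x∉ ∘ cancelʳ∈ sK y∈)) (xyu≡xuy x y)
    ... | no  x∉ | no  y∉ = trans (shear-∈ (index₂ x∉ y∉)) (sym (begin
        x ∙ u ∙ (y ∙ u)  ≡⟨ sym (assoc (x ∙ u) y u) ⟩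
        x ∙ u ∙ y ∙ u    ≡⟨ cong (_∙ u) (sym (xyu≡xuy x y)) ⟩
        x ∙ y ∙ u ∙ u    ≡⟨ xuu≡x (x ∙ y) ⟩
        x ∙ y            ∎))
      where open ≡-Reasoning

    shear-S : ∀ x → S (shear x) ≡ S x
    shear-S x with mem? sK x
    ... | yes _  = refl
    ... | no  x∉ = S-inv x∉

    -- `shear` is an automorphism preserving `S`, hence the identity, but it moves every element off
    -- `K` by `u`. The hypothesis `index₂` bounds the index of `K` by 2 and so allows `K` to be
    -- everything.
    shear-trivial : ∀ x → K x
    shear-trivial x with mem? sK x
    ... | yes x∈ = x∈
    ... | no  x∉ = contradiction (x∙y≡x⇒y≡ε (trans (sym (shear-∉ x∉))
      (autS shear (shear-∙ , shear , shear-involutive , shear-involutive) (λ x _ → shear-S x) x))) u≢ε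

  -- In the Klein four-group {ε, a, b, ab} the shear along ab swaps a and b.
  klein-four : ∀ {S a b} → AutTrivial S → a ∙ b ≡ b ∙ a → a ∙ a ≡ ε → b ∙ b ≡ ε →
    a ≢ ε → b ≢ ε → a ≢ b → (∀ x → x ≡ ε ⊎ x ≡ a ⊎ x ≡ b ⊎ x ≡ a ∙ b) → S a ≢ S b
  klein-four {S} {a} {b} autS ab≡ba aa≡ε bb≡ε a≢ε b≢ε a≢b elements Sa≡Sb =
    -- `shear-trivial` puts `a` into the subgroup with elements `ε` and `a ∙ b`.
    [ a≢ε , (λ a≡ab → b≢ε (x∙y≡x⇒y≡ε (sym a≡ab))) ]′ (shear-trivial a)
    where
    c = a ∙ b
    ca≡b : c ∙ a ≡ b
    ca≡b = trans (cong (_∙ a) ab≡ba) (trans (assoc b a a) (trans (cong (b ∙_) aa≡ε) (identityʳ b)))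
    cb≡a : c ∙ b ≡ a
    cb≡a = trans (assoc a b b) (trans (cong (a ∙_) bb≡ε) (identityʳ a))
    ac≡b : a ∙ c ≡ b
    ac≡b = trans (sym (assoc a a b)) (trans (cong (_∙ b) aa≡ε) (identityˡ b))
    bc≡a : b ∙ c ≡ a
    bc≡a = trans (cong (b ∙_) ab≡ba) (trans (sym (assoc b b a)) (trans (cong (_∙ a) bb≡ε) (identityˡ a)))
    cc≡ε : c ∙ c ≡ ε
    cc≡ε = trans (sym (assoc c a b)) (trans (cong (_∙ b) ca≡b) bb≡ε)
    K : Pred C 0ℓ
    K x = x ≡ ε ⊎ x ≡ c
    K-∙ : ∀ {x y} → K x → K y → K (x ∙ y)
    K-∙ (inj₁ refl) (inj₁ refl) = inj₁ (identityˡ ε)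
    K-∙ (inj₁ refl) (inj₂ refl) = inj₂ (identityˡ c)
    K-∙ (inj₂ refl) (inj₁ refl) = inj₂ (identityʳ c)
    K-∙ (inj₂ refl) (inj₂ refl) = inj₁ cc≡ε
    sK : Subgroup K
    sK = record
      { mem? = λ x → x ≟ ε ⊎-dec x ≟ c ; ε∈ = inj₁ refl ; ∙∈ = K-∙
      ; ⁻¹∈ = λ { (inj₁ refl) → inj₁ ε⁻¹≈ε ; (inj₂ refl) → inj₂ (sym (inverseˡ-unique c c cc≡ε)) } }
    outside : ∀ {x} → ¬ K x → x ≡ a ⊎ x ≡ b
    outside {x} x∉ with elements x
    ... | inj₁ x≡ε               = contradiction (inj₁ x≡ε) x∉
    ... | inj₂ (inj₁ x≡a)        = inj₁ x≡a
    ... | inj₂ (inj₂ (inj₁ x≡b)) = inj₂ x≡b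
    ... | inj₂ (inj₂ (inj₂ x≡c)) = contradiction (inj₂ x≡c) x∉
    central : ∀ x → c ∙ x ≡ x ∙ c
    central x with elements x
    ... | inj₁ refl               = trans (identityʳ c) (sym (identityˡ c))
    ... | inj₂ (inj₁ refl)        = trans ca≡b (sym ac≡b)
    ... | inj₂ (inj₂ (inj₁ refl)) = trans cb≡a (sym bc≡a)
    ... | inj₂ (inj₂ (inj₂ refl)) = refl
    index₂ : ∀ {x y} → ¬ K x → ¬ K y → K (x ∙ y)
    index₂ x∉ y∉ with outside x∉ | outside y∉
    ... | inj₁ refl | inj₁ refl = inj₁ aa≡ε
    ... | inj₁ refl | inj₂ refl = inj₂ refl
    ... | inj₂ refl | inj₁ refl = inj₂ (sym ab≡ba)
    ... | inj₂ refl | inj₂ refl = inj₁ bb≡ε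
    S-inv : ∀ {x} → ¬ K x → S (x ∙ c) ≡ S x
    S-inv x∉ with outside x∉
    ... | inj₁ refl = trans (cong S ac≡b) (sym Sa≡Sb)
    ... | inj₂ refl = trans (cong S bc≡a) Sa≡Sb
    c≢ε : c ≢ ε
    c≢ε c≡ε = a≢b (trans (inverseˡ-unique a b c≡ε) (sym (inverseˡ-unique b b bb≡ε)))
    open Shear autS sK c≢ε cc≡ε (inj₂ refl) central index₂ S-inv

  -- Decompositions of a set and of its complement.

  record Configuration (S : C → Bool) (P Q P′ Q′ : Pred C 0ℓ) : Set where
    field
      autS   : AutTrivial S
      pair   : ProperPair P Q
      pair′  : ProperPair P′ Q′
      cover  : Covers S P Q
      cover′ : Covers (not ∘ S) P′ Q′
    open ProperPair pair public
    open ProperPair pair′ public renaming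
      ( subP to subP′; subQ to subQ′; commute to commute′; disjoint to disjoint′
      ; properP to properP′; properQ to properQ′)

    cover-all : ∀ x → (P x ⊎ Q x) ⊎ (P′ x ⊎ Q′ x)
    cover-all x with x ≟ ε | S x in Sx
    ... | yes refl | _     = inj₁ (inj₁ (ε∈ subP))
    ... | no  x≢ε  | true  = inj₁ (cover x≢ε Sx)
    ... | no  x≢ε  | false = inj₂ (cover′ x≢ε (cong not Sx))

    ∉⇒S≡true : ∀ {x} → x ≢ ε → ¬ P′ x → ¬ Q′ x → S x ≡ true
    ∉⇒S≡true {x} x≢ε x∉P′ x∉Q′ with S x in Sx
    ... | true  = refl
    ... | false = ⊥-elim ([ x∉P′ , x∉Q′ ]′ (cover′ x≢ε (cong not Sx)))

    ∉⇒S≡false : ∀ {x} → x ≢ ε → ¬ P x → ¬ Q x → S x ≡ false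
    ∉⇒S≡false {x} x≢ε x∉P x∉Q with S x in Sx
    ... | false = refl
    ... | true  = ⊥-elim ([ x∉P , x∉Q ]′ (cover x≢ε Sx))

    -- Were `x ∙ y` in `P` or `Q`, cancelling would put `y` into `P` or `x` into `Q`, against
    -- `disjoint`. Only the other pair is left to cover it.
    cross : ∀ {x y} → P x → x ≢ ε → Q y → y ≢ ε → P′ (x ∙ y) ⊎ Q′ (x ∙ y)
    cross {x} {y} x∈ x≢ε y∈ y≢ε with cover-all (x ∙ y)
    ... | inj₂ xy∈        = xy∈
    ... | inj₁ (inj₁ xy∈) = contradiction (disjoint (cancelˡ∈ subP x∈ xy∈) y∈) y≢ε
    ... | inj₁ (inj₂ xy∈) = contradiction (disjoint x∈ (cancelʳ∈ subQ y∈ xy∈)) x≢ε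

  -- With `flipʳ` and `dual`, this provides the symmetries of a configuration: a fact proved about
  -- one of the four subgroups is reused for the others.
  flipˡ : ∀ {S P Q P′ Q′} → Configuration S P Q P′ Q′ → Configuration S Q P P′ Q′
  flipˡ c = record { Configuration c hiding (pair; cover)
    ; pair = flip-pair (Configuration.pair c) ; cover = λ x≢ε Sx → swap (Configuration.cover c x≢ε Sx) }

  flipʳ : ∀ {S P Q P′ Q′} → Configuration S P Q P′ Q′ → Configuration S P Q Q′ P′
  flipʳ c = record { Configuration c hiding (pair′; cover′)
    ; pair′ = flip-pair (Configuration.pair′ c) ; cover′ = λ x≢ε Sx → swap (Configuration.cover′ c x≢ε Sx) }

  dual : ∀ {S P Q P′ Q′} → Configuration S P Q P′ Q′ → Configuration (not ∘ S) P′ Q′ P Q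
  dual {S} c = record
    { autS = autTrivial-not {S} autS ; pair = pair′ ; pair′ = pair
    ; cover = cover′ ; cover′ = λ x≢ε Sx → cover x≢ε (trans (sym (not-involutive _)) Sx) }
    where open Configuration c

  -- The case of a trivial subgroup.

  module TrivialFactor {S P Q P′ Q′} (c : Configuration S P Q P′ Q′)
    (Q-trivial : ∀ {x} → Q x → x ≡ ε) where
    open Configuration c

    cover₃ : ∀ x → P x ⊎ (P′ x ⊎ Q′ x)
    cover₃ x with cover-all x
    ... | inj₁ (inj₁ x∈P) = inj₁ x∈P
    ... | inj₁ (inj₂ x∈Q) = inj₁ (subst P (sym (Q-trivial x∈Q)) (ε∈ subP))
    ... | inj₂ x∈         = inj₂ x∈

    product∈P : ∀ {x y} → P′ x → x ≢ ε → Q′ y → y ≢ ε → P (x ∙ y)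
    product∈P {x} {y} x∈ x≢ε y∈ y≢ε with cover₃ (x ∙ y)
    ... | inj₁ xy∈         = xy∈
    ... | inj₂ (inj₁ xy∈P′) = contradiction (disjoint′ (cancelˡ∈ subP′ x∈ xy∈P′) y∈) y≢ε
    ... | inj₂ (inj₂ xy∈Q′) = contradiction (disjoint′ x∈ (cancelʳ∈ subQ′ y∈ xy∈Q′)) x≢ε

    -- Otherwise the proper subgroups `P` and `P′` alone would cover the group.
    Q′-nontrivial : ∃ λ y → Q′ y × y ≢ ε
    Q′-nontrivial with search (λ x → mem? subQ′ x ×-dec ¬? (x ≟ ε))
    ... | yes found = found
    ... | no none = ⊥-elim (two-cover subP subP′ properP properP′ cover₂)
      where
      cover₂ : ∀ x → P x ⊎ P′ x
      cover₂ x with cover₃ x | x ≟ ε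
      ... | inj₁ x∈         | _        = inj₁ x∈
      ... | inj₂ (inj₁ x∈) | _        = inj₂ x∈
      ... | inj₂ (inj₂ x∈) | yes refl = inj₁ (ε∈ subP)
      ... | inj₂ (inj₂ x∈) | no x≢ε   = contradiction (x , x∈ , x≢ε) none

  module TrivialFactorUniqueness {S P Q P′ Q′} (c : Configuration S P Q P′ Q′)
    (Q-trivial : ∀ {x} → Q x → x ≡ ε) where
    open Configuration c
    open TrivialFactor c Q-trivial
    open TrivialFactor (flipʳ c) Q-trivial using () renaming (Q′-nontrivial to P′-nontrivial)

    -- Suppose `y` is in `P`. As `x ∙ y` is in `P` for all nontrivial `x` in `P′`, so is `x`, whence
    -- `P′` is contained in `P`. Multiplying by a nontrivial element of `P′` gives the same for
    -- `Q′`, and `P` is everything.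
    Q′⊈P : ∀ {y} → Q′ y → y ≢ ε → ¬ P y
    Q′⊈P {y} y∈Q′ y≢ε y∈P = proj₂ properP (all (proj₁ properP))
      where
      P′⊆P : ∀ {x} → P′ x → P x
      P′⊆P {x} x∈ with x ≟ ε
      ... | yes refl = ε∈ subP
      ... | no x≢ε   = cancelʳ∈ subP y∈P (product∈P x∈ x≢ε y∈Q′ y≢ε)
      Q′⊆P : ∀ {x} → Q′ x → P x
      Q′⊆P {x} x∈ with x ≟ ε | P′-nontrivial
      ... | yes refl | _               = ε∈ subP
      ... | no x≢ε   | p , p∈ , p≢ε = cancelˡ∈ subP (P′⊆P p∈) (product∈P p∈ p≢ε x∈ x≢ε)
      all : ∀ x → P x
      all x = [ id , [ P′⊆P , Q′⊆P ]′ ]′ (cover₃ x)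

    -- Let `r` be the quotient `x // y` and `q` a nontrivial element of `Q′`. Both `x ∙ q` and
    -- `y ∙ q` lie in `P`, hence so does `r`. If `r` were nontrivial, `r ∙ q` would lie in `P` too,
    -- and then `q`, against `Q′⊈P`.
    P′-unique : ∀ {x y} → P′ x → x ≢ ε → P′ y → y ≢ ε → x ≡ y
    P′-unique {x} {y} x∈ x≢ε y∈ y≢ε with Q′-nontrivial | (x // y) ≟ ε
    ... | _               | yes x//y≡ε = x∙y⁻¹≈ε⇒x≈y x y x//y≡ε
    ... | q , q∈ , q≢ε | no  r≢ε    = contradiction (cancelˡ∈ subP r∈P (product∈P r∈P′ r≢ε q∈ q≢ε)) (Q′⊈P q∈ q≢ε)
      where
      r∈P′ : P′ (x // y)
      r∈P′ = ∙∈ subP′ x∈ (⁻¹∈ subP′ y∈)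
      r∈P : P (x // y)
      r∈P = cancelʳ∈ subP (product∈P y∈ y≢ε q∈ q≢ε)
        (subst P (sym (trans (sym (assoc (x // y) y q)) (cong (_∙ q) (//-rightDividesˡ y x))))
          (product∈P x∈ x≢ε q∈ q≢ε))

  -- Now `P′` and `Q′` have order 2, generated by `p` and `q`, and the group is the Klein four-group
  -- they span. Both `p` and `q` are outside `P` and `Q`, so `S` is false at both, which
  -- `klein-four` forbids.
  trivialFactor-impossible : ∀ {S P Q P′ Q′} → Configuration S P Q P′ Q′ → ¬ (∀ {x} → Q x → x ≡ ε)
  trivialFactor-impossible {S} {P} {Q} {P′} {Q′} c Q-trivial =
    let (q , q∈ , q≢ε) = Q′-nontrivial
        (p , p∈ , p≢ε) = P′-nontrivial
    in proof p∈ p≢ε q∈ q≢ε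
    where
    open Configuration c
    open TrivialFactor c Q-trivial using (cover₃; Q′-nontrivial)
    open TrivialFactor (flipʳ c) Q-trivial using () renaming (Q′-nontrivial to P′-nontrivial)
    open TrivialFactorUniqueness c Q-trivial using (P′-unique; Q′⊈P)
    open TrivialFactorUniqueness (flipʳ c) Q-trivial using () renaming (P′-unique to Q′-unique; Q′⊈P to P′⊈P)

    proof : ∀ {p q} → P′ p → p ≢ ε → Q′ q → q ≢ ε → ⊥
    proof {p} {q} p∈ p≢ε q∈ q≢ε =
      klein-four autS pq≡qp pp≡ε qq≡ε p≢ε q≢ε p≢q elements
        (trans (S≡false p≢ε p∉P) (sym (S≡false q≢ε q∉P)))
      where
      p∉P : ¬ P p
      p∉P = P′⊈P p∈ p≢ε
      q∉P : ¬ P q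
      q∉P = Q′⊈P q∈ q≢ε
      p≢q : p ≢ q
      p≢q refl = p≢ε (disjoint′ p∈ q∈)
      pq≡qp : p ∙ q ≡ q ∙ p
      pq≡qp = commute′ p∈ q∈
      p≡p⁻¹ : p ≡ p ⁻¹
      p≡p⁻¹ = P′-unique p∈ p≢ε (⁻¹∈ subP′ p∈) (⁻¹-≢ε p≢ε)
      pp≡ε : p ∙ p ≡ ε
      pp≡ε = trans (cong (p ∙_) p≡p⁻¹) (inverseʳ p)
      qq≡ε : q ∙ q ≡ ε
      qq≡ε = trans (cong (q ∙_) (Q′-unique q∈ q≢ε (⁻¹∈ subQ′ q∈) (⁻¹-≢ε q≢ε))) (inverseʳ q)
      S≡false : ∀ {x} → x ≢ ε → ¬ P x → S x ≡ false
      S≡false x≢ε x∉P = ∉⇒S≡false x≢ε x∉P (x≢ε ∘ Q-trivial)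
      xp≡y⇒x≡yp : ∀ {x y} → x ∙ p ≡ y → x ≡ y ∙ p
      xp≡y⇒x≡yp {x} {y} xp≡y = trans (x≈z//y x p y xp≡y) (cong (y ∙_) (sym p≡p⁻¹))
      outside-P : ∀ {x} → P′ x ⊎ Q′ x → x ≡ ε ⊎ x ≡ p ⊎ x ≡ q
      outside-P {x} x∈ with x ≟ ε | x∈
      ... | yes x≡ε | _          = inj₁ x≡ε
      ... | no x≢ε  | inj₁ x∈P′ = inj₂ (inj₁ (P′-unique x∈P′ x≢ε p∈ p≢ε))
      ... | no x≢ε  | inj₂ x∈Q′ = inj₂ (inj₂ (Q′-unique x∈Q′ x≢ε q∈ q≢ε))
      elements : ∀ x → x ≡ ε ⊎ x ≡ p ⊎ x ≡ q ⊎ x ≡ p ∙ q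
      elements x with cover₃ x
      ... | inj₂ x∈ with outside-P x∈
      ...   | inj₁ e        = inj₁ e
      ...   | inj₂ (inj₁ e) = inj₂ (inj₁ e)
      ...   | inj₂ (inj₂ e) = inj₂ (inj₂ (inj₁ e))
      -- Since `p` is outside `P`, so is `x ∙ p`, which must be `ε`, `p` or `q`.
      elements x | inj₁ x∈P with cover₃ (x ∙ p)
      ... | inj₁ xp∈P = contradiction (cancelˡ∈ subP x∈P xp∈P) p∉P
      ... | inj₂ xp∈ with outside-P xp∈
      ...   | inj₁ e        = contradiction (subst P (trans (xp≡y⇒x≡yp e) (identityˡ p)) x∈P) p∉P
      ...   | inj₂ (inj₁ e) = inj₁ (trans (xp≡y⇒x≡yp e) pp≡ε)
      ...   | inj₂ (inj₂ e) = inj₂ (inj₂ (inj₂ (trans (xp≡y⇒x≡yp e) (sym pq≡qp))))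

  Q-nontrivial : ∀ {S P Q P′ Q′} → Configuration S P Q P′ Q′ → ∃ λ x → Q x × x ≢ ε
  Q-nontrivial c with search (λ x → mem? subQ x ×-dec ¬? (x ≟ ε)) where open Configuration c
  ... | yes found = found
  ... | no  none  = ⊥-elim (trivialFactor-impossible c
    (λ {x} x∈ → decidable-stable (x ≟ ε) (λ x≢ε → none (x , x∈ , x≢ε))))

  -- A nontrivial element shared by the two pairs.

  module SharedElement {S P Q P′ Q′} (c : Configuration S P Q P′ Q′)
    {u} (u≢ε : u ≢ ε) (u∈P : P u) (u∈P′ : P′ u) where
    open Configuration c

    -- A nontrivial `w` here would force `P` and `Q` into `P′`, leaving `P′` and `Q′` to cover the
    -- group. Indeed, for `x` in `P` off `P′`, `cross` puts `x ∙ w` and `u ∙ (x ∙ w)` into `Q′`,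
    -- hence also `u`. For `x` in `Q` off `P′`, it puts `u ∙ x` and `u ∙ x ∙ w` there, hence also
    -- `w`.
    Q∩P′-trivial : ∀ {w} → Q w → P′ w → w ≡ ε
    Q∩P′-trivial {w} w∈Q w∈P′ with w ≟ ε
    ... | yes w≡ε = w≡ε
    ... | no  w≢ε = ⊥-elim (two-cover subP′ subQ′ properP′ properQ′ cover₂)
      where
      P⊆P′ : ∀ {x} → P x → P′ x
      P⊆P′ {x} x∈ with mem? subP′ x
      ... | yes x∈P′ = x∈P′
      ... | no  x∉P′ = contradiction (disjoint′ u∈P′ (cancelʳ∈ subQ′ xw∈Q′ uxw∈Q′)) u≢ε
        where
        step : ∀ {y} → P y → ¬ P′ y → Q′ (y ∙ w)
        step y∈ y∉P′ with cross y∈ (λ { refl → y∉P′ (ε∈ subP′) }) w∈Q w≢ε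
        ... | inj₁ yw∈P′ = contradiction (cancelʳ∈ subP′ w∈P′ yw∈P′) y∉P′
        ... | inj₂ yw∈Q′ = yw∈Q′
        xw∈Q′ : Q′ (x ∙ w)
        xw∈Q′ = step x∈ x∉P′
        uxw∈Q′ : Q′ (u ∙ (x ∙ w))
        uxw∈Q′ = subst Q′ (assoc u x w) (step (∙∈ subP u∈P x∈) (x∉P′ ∘ cancelˡ∈ subP′ u∈P′))
      Q⊆P′ : ∀ {x} → Q x → P′ x
      Q⊆P′ {x} x∈ with mem? subP′ x
      ... | yes x∈P′ = x∈P′
      ... | no  x∉P′ = contradiction (disjoint′ w∈P′ (cancelˡ∈ subQ′ ux∈Q′ uxw∈Q′)) w≢ε
        where
        step : ∀ {y} → Q y → ¬ P′ y → Q′ (u ∙ y)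
        step y∈ y∉P′ with cross u∈P u≢ε y∈ (λ { refl → y∉P′ (ε∈ subP′) })
        ... | inj₁ uy∈P′ = contradiction (cancelˡ∈ subP′ u∈P′ uy∈P′) y∉P′
        ... | inj₂ uy∈Q′ = uy∈Q′
        ux∈Q′ : Q′ (u ∙ x)
        ux∈Q′ = step x∈ x∉P′
        uxw∈Q′ : Q′ (u ∙ x ∙ w)
        uxw∈Q′ = subst Q′ (sym (assoc u x w)) (step (∙∈ subQ x∈ w∈Q) (x∉P′ ∘ cancelʳ∈ subP′ w∈P′))
      cover₂ : ∀ x → P′ x ⊎ Q′ x
      cover₂ x with cover-all x
      ... | inj₁ (inj₁ x∈) = inj₁ (P⊆P′ x∈)
      ... | inj₁ (inj₂ x∈) = inj₁ (Q⊆P′ x∈)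
      ... | inj₂ x∈        = x∈

    shared∙Q⊆Q′ : ∀ {v y} → v ≢ ε → P v → P′ v → Q y → y ≢ ε → Q′ (v ∙ y)
    shared∙Q⊆Q′ v≢ε v∈P v∈P′ y∈ y≢ε with cross v∈P v≢ε y∈ y≢ε
    ... | inj₁ vy∈P′ = contradiction (Q∩P′-trivial y∈ (cancelˡ∈ subP′ v∈P′ vy∈P′)) y≢ε
    ... | inj₂ vy∈Q′ = vy∈Q′

    -- Let `w` be the quotient of `y` by `x`. As `u ∙ x` and `u ∙ y` lie in `Q′`, so does `w`. If
    -- `w` were nontrivial, `u ∙ w` would lie in `Q′` as well, and with it `u`.
    Q-unique : ∀ {x y} → Q x → x ≢ ε → Q y → y ≢ ε → x ≡ y
    Q-unique {x} {y} x∈ x≢ε y∈ y≢ε with x \\ y ≟ ε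
    ... | yes w≡ε = ⁻¹-injective (inverseˡ-unique _ _ w≡ε)
    ... | no  w≢ε = contradiction (disjoint′ u∈P′ (cancelʳ∈ subQ′ w∈Q′ uw∈Q′)) u≢ε
      where
      w∈Q′ : Q′ (x \\ y)
      w∈Q′ = cancelˡ∈ subQ′ (shared∙Q⊆Q′ u≢ε u∈P u∈P′ x∈ x≢ε)
        (subst Q′ (sym (trans (assoc u x (x \\ y)) (cong (u ∙_) (\\-leftDividesˡ x y))))
          (shared∙Q⊆Q′ u≢ε u∈P u∈P′ y∈ y≢ε))
      uw∈Q′ : Q′ (u ∙ (x \\ y))
      uw∈Q′ = shared∙Q⊆Q′ u≢ε u∈P u∈P′ (∙∈ subQ (⁻¹∈ subQ x∈) y∈) w≢ε

    -- For nontrivial `q` in `Q`, both `v ∙ q` and `u ∙ q` lie in `Q′`, so `v // u` lies in `P′` and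
    -- in `Q′`.
    P∩P′-unique : ∀ {v} → P v → P′ v → v ≢ ε → v ≡ u
    P∩P′-unique {v} v∈P v∈P′ v≢ε with Q-nontrivial c
    ... | q , q∈ , q≢ε = x∙y⁻¹≈ε⇒x≈y v u (disjoint′ (∙∈ subP′ v∈P′ (⁻¹∈ subP′ u∈P′))
      (cancelʳ∈ subQ′ (shared∙Q⊆Q′ u≢ε u∈P u∈P′ q∈ q≢ε)
        (subst Q′ (sym (trans (sym (assoc (v // u) u q)) (cong (_∙ q) (//-rightDividesˡ u v))))
          (shared∙Q⊆Q′ v≢ε v∈P v∈P′ q∈ q≢ε))))

  -- Excluding a shared element by a shear.

  module SharedElementElimination {S P Q P′ Q′} (c : Configuration S P Q P′ Q′)
    {u} (u≢ε : u ≢ ε) (u∈P : P u) (u∈P′ : P′ u) where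
    open Configuration c
    open SharedElement c u≢ε u∈P u∈P′
    open SharedElement (dual c) u≢ε u∈P′ u∈P using () renaming (Q-unique to Q′-unique)

    -- By `Q-unique` this is the only nontrivial element of `Q`; likewise `u ∙ q` is the only one of
    -- `Q′`.
    q : C
    q = proj₁ (Q-nontrivial c)
    q∈Q : Q q
    q∈Q = proj₁ (proj₂ (Q-nontrivial c))
    q≢ε : q ≢ ε
    q≢ε = proj₂ (proj₂ (Q-nontrivial c))

    uq≡qu : u ∙ q ≡ q ∙ u
    uq≡qu = commute u∈P q∈Q
    uu≡ε : u ∙ u ≡ ε
    uu≡ε = trans (cong (_∙ u) (sym (P∩P′-unique (⁻¹∈ subP u∈P) (⁻¹∈ subP′ u∈P′) (⁻¹-≢ε u≢ε)))) (inverseˡ u)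
    qq≡ε : q ∙ q ≡ ε
    qq≡ε = trans (cong (_∙ q) (Q-unique q∈Q q≢ε (⁻¹∈ subQ q∈Q) (⁻¹-≢ε q≢ε))) (inverseˡ q)
    xqq≡x : ∀ x → x ∙ q ∙ q ≡ x
    xqq≡x x = trans (assoc x q q) (trans (cong (x ∙_) qq≡ε) (identityʳ x))
    uq∈Q′ : Q′ (u ∙ q)
    uq∈Q′ = shared∙Q⊆Q′ u≢ε u∈P u∈P′ q∈Q q≢ε
    q∉P : ¬ P q
    q∉P q∈P = q≢ε (disjoint q∈P q∈Q)
    q∉P′ : ¬ P′ q
    q∉P′ q∈P′ = q≢ε (Q∩P′-trivial q∈Q q∈P′)
    q∉Q′ : ¬ Q′ q
    q∉Q′ q∈Q′ = u≢ε (disjoint′ u∈P′ (cancelʳ∈ subQ′ q∈Q′ uq∈Q′))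
    uq≢ε : u ∙ q ≢ ε
    uq≢ε uq≡ε = q∉P (cancelˡ∈ subP u∈P (subst P (sym uq≡ε) (ε∈ subP)))
    Q-elements : ∀ {x} → Q x → x ≡ ε ⊎ x ≡ q
    Q-elements {x} x∈ with x ≟ ε
    ... | yes x≡ε = inj₁ x≡ε
    ... | no  x≢ε = inj₂ (Q-unique x∈ x≢ε q∈Q q≢ε)
    Q′-elements : ∀ {x} → Q′ x → x ≡ ε ⊎ x ≡ u ∙ q
    Q′-elements {x} x∈ with x ≟ ε
    ... | yes x≡ε = inj₁ x≡ε
    ... | no  x≢ε = inj₂ (Q′-unique x∈ x≢ε uq∈Q′ uq≢ε)

    -- The elements of `Q` and `Q′` are known. For `x` in `P′`, `cross` puts `x ∙ (u ∙ q)` into `P`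
    -- or `Q`. In the first case `x ∙ q` is in `P`; in the second `x ∙ u` lies in `Q` and `P′`, so
    -- that `x` is `u`.
    P∪Pq : ∀ x → P x ⊎ P (x ∙ q)
    P∪Pq x with cover-all x
    ... | inj₁ (inj₁ x∈P) = inj₁ x∈P
    ... | inj₁ (inj₂ x∈Q) with Q-elements x∈Q
    ...   | inj₁ refl = inj₁ (ε∈ subP)
    ...   | inj₂ refl = inj₂ (subst P (sym qq≡ε) (ε∈ subP))
    P∪Pq x | inj₂ (inj₂ x∈Q′) with Q′-elements x∈Q′
    ... | inj₁ refl = inj₁ (ε∈ subP)
    ... | inj₂ refl = inj₂ (subst P (sym (xqq≡x u)) u∈P)
    P∪Pq x | inj₂ (inj₁ x∈P′) with x ≟ ε
    ... | yes refl = inj₁ (ε∈ subP)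
    ... | no  x≢ε  with Configuration.cross (dual c) x∈P′ x≢ε uq∈Q′ uq≢ε
    ...   | inj₁ xuq∈P = inj₂ (cancelʳ∈ subP u∈P
        (subst P (trans (cong (x ∙_) uq≡qu) (sym (assoc x q u))) xuq∈P))
    ...   | inj₂ xuq∈Q = inj₁ (subst P (trans (inverseˡ-unique u u uu≡ε) (sym (inverseˡ-unique x u xu≡ε))) u∈P)
      where
      xu≡ε : x ∙ u ≡ ε
      xu≡ε = Q∩P′-trivial (cancelʳ∈ subQ q∈Q (subst Q (sym (assoc x u q)) xuq∈Q)) (∙∈ subP′ x∈P′ u∈P′)

    q-central : ∀ x → q ∙ x ≡ x ∙ q
    q-central x with P∪Pq x
    ... | inj₁ x∈  = sym (commute x∈ q∈Q)
    ... | inj₂ xq∈ = ∙-cancelʳ q (q ∙ x) (x ∙ q) (trans (assoc q x q) (sym (commute xq∈ q∈Q)))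

    -- By `P∩P′-unique` this is the subgroup of order 2 generated by `u`.
    L : Pred C 0ℓ
    L x = P x × P′ x

    xq∈P′ : ∀ {x} → P x → ¬ L x → P′ (x ∙ q)
    xq∈P′ {x} x∈ x∉L with cross x∈ (λ { refl → x∉L (ε∈ subP , ε∈ subP′) }) q∈Q q≢ε
    ... | inj₁ xq∈P′ = xq∈P′
    ... | inj₂ xq∈Q′ = contradiction
      (u∈P , u∈P′) (subst (λ y → ¬ L y) (x≡u (Q′-elements xq∈Q′)) x∉L)
      where
      x≡u : x ∙ q ≡ ε ⊎ x ∙ q ≡ u ∙ q → x ≡ u
      x≡u (inj₂ xq≡uq) = ∙-cancelʳ q x u xq≡uq
      x≡u (inj₁ xq≡ε)  = contradiction (cancelˡ∈ subP x∈ (subst P (sym xq≡ε) (ε∈ subP))) q∉P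

    -- The conjugate of `u` by `x` is a nontrivial element of `P`. It also lies in `P′`: if `x` does
    -- not, then `x ∙ q` does, and conjugating `u` by `x ∙ q` has the same effect because `q` is
    -- central. By `P∩P′-unique` the conjugate is `u`.
    u-central-P : ∀ {x} → P x → u ∙ x ≡ x ∙ u
    u-central-P {x} x∈ = sym (trans (x≈z//y (x ∙ u) (x ⁻¹) u xux⁻¹≡u) (cong (u ∙_) (⁻¹-involutive x)))
      where
      xqu≡xuq : x ∙ q ∙ u ≡ x ∙ u ∙ q
      xqu≡xuq = trans (assoc x q u) (trans (cong (x ∙_) (sym uq≡qu)) (sym (assoc x u q)))
      conj∈P′ : P′ (x ∙ u ∙ x ⁻¹)
      conj∈P′ with mem? subP′ x
      ... | yes x∈P′ = ∙∈ subP′ (∙∈ subP′ x∈P′ u∈P′) (⁻¹∈ subP′ x∈P′)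
      ... | no  x∉P′ = subst P′ (begin
          x ∙ q ∙ u ∙ (x ∙ q) ⁻¹     ≡⟨ cong₂ _∙_ xqu≡xuq (trans (cong _⁻¹ (sym (q-central x))) (⁻¹-anti-homo-∙ q x)) ⟩
          x ∙ u ∙ q ∙ (x ⁻¹ ∙ q ⁻¹)  ≡⟨ assoc (x ∙ u) q (x ⁻¹ ∙ q ⁻¹) ⟩
          x ∙ u ∙ (q ∙ (x ⁻¹ ∙ q ⁻¹)) ≡⟨ cong (x ∙ u ∙_) (trans (sym (assoc q (x ⁻¹) (q ⁻¹)))
            (trans (cong (_∙ q ⁻¹) (q-central (x ⁻¹))) (//-rightDividesʳ q (x ⁻¹)))) ⟩
          x ∙ u ∙ x ⁻¹               ∎)
          (∙∈ subP′ (∙∈ subP′ xq∈ u∈P′) (⁻¹∈ subP′ xq∈))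
        where
        open ≡-Reasoning
        xq∈ = xq∈P′ x∈ (x∉P′ ∘ proj₂)
      xux⁻¹≡u : x ∙ u ∙ x ⁻¹ ≡ u
      xux⁻¹≡u = P∩P′-unique (∙∈ subP (∙∈ subP x∈ u∈P) (⁻¹∈ subP x∈)) conj∈P′
        (λ e → u≢ε (x∙y≡x⇒y≡ε (x∙y⁻¹≈ε⇒x≈y (x ∙ u) x e)))

    u-central : ∀ x → u ∙ x ≡ x ∙ u
    u-central x with P∪Pq x
    ... | inj₁ x∈  = u-central-P x∈
    ... | inj₂ xq∈ = ∙-cancelʳ q (u ∙ x) (x ∙ u) (begin
      u ∙ x ∙ q   ≡⟨ assoc u x q ⟩
      u ∙ (x ∙ q) ≡⟨ u-central-P xq∈ ⟩
      x ∙ q ∙ u   ≡⟨ assoc x q u ⟩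
      x ∙ (q ∙ u) ≡⟨ cong (x ∙_) (sym uq≡qu) ⟩
      x ∙ (u ∙ q) ≡⟨ sym (assoc x u q) ⟩
      x ∙ u ∙ q   ∎)
      where open ≡-Reasoning

    -- The subgroup generated by `u` and `q`, along which the group is sheared.
    K : Pred C 0ℓ
    K x = L x ⊎ L (x ∙ q)

    sL : Subgroup L
    sL = record
      { mem? = λ x → mem? subP x ×-dec mem? subP′ x
      ; ε∈   = ε∈ subP , ε∈ subP′
      ; ∙∈   = λ (x∈P , x∈P′) (y∈P , y∈P′) → ∙∈ subP x∈P y∈P , ∙∈ subP′ x∈P′ y∈P′
      ; ⁻¹∈  = λ (x∈P , x∈P′) → ⁻¹∈ subP x∈P , ⁻¹∈ subP′ x∈P′ }

    xyq≡xqy : ∀ x y → x ∙ y ∙ q ≡ x ∙ q ∙ y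
    xyq≡xqy x y = trans (assoc x y q) (trans (cong (x ∙_) (sym (q-central y))) (sym (assoc x q y)))

    xqyq≡xy : ∀ x y → x ∙ q ∙ (y ∙ q) ≡ x ∙ y
    xqyq≡xy x y = trans (sym (assoc (x ∙ q) y q)) (trans (cong (_∙ q) (sym (xyq≡xqy x y))) (xqq≡x (x ∙ y)))

    K-∙ : ∀ {x y} → K x → K y → K (x ∙ y)
    K-∙         (inj₁ x∈)  (inj₁ y∈)  = inj₁ (∙∈ sL x∈ y∈)
    K-∙ {x} {y} (inj₁ x∈)  (inj₂ yq∈) = inj₂ (subst L (sym (assoc x y q)) (∙∈ sL x∈ yq∈))
    K-∙ {x} {y} (inj₂ xq∈) (inj₁ y∈)  = inj₂ (subst L (sym (xyq≡xqy x y)) (∙∈ sL xq∈ y∈))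
    K-∙ {x} {y} (inj₂ xq∈) (inj₂ yq∈) = inj₁ (subst L (xqyq≡xy x y) (∙∈ sL xq∈ yq∈))

    K-⁻¹ : ∀ {x} → K x → K (x ⁻¹)
    K-⁻¹ (inj₁ x∈)  = inj₁ (⁻¹∈ sL x∈)
    K-⁻¹ {x} (inj₂ xq∈) = inj₂ (subst L (begin
        (x ∙ q) ⁻¹  ≡⟨ cong _⁻¹ (sym (q-central x)) ⟩
        (q ∙ x) ⁻¹  ≡⟨ ⁻¹-anti-homo-∙ q x ⟩
        x ⁻¹ ∙ q ⁻¹ ≡⟨ cong (x ⁻¹ ∙_) (sym (inverseˡ-unique q q qq≡ε)) ⟩
        x ⁻¹ ∙ q    ∎) (⁻¹∈ sL xq∈))
      where open ≡-Reasoning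

    sK : Subgroup K
    sK = record
      { mem? = λ x → mem? sL x ⊎-dec mem? sL (x ∙ q)
      ; ε∈ = inj₁ (ε∈ sL) ; ∙∈ = K-∙ ; ⁻¹∈ = K-⁻¹ }

    -- By `xq∈P′` both `x ∙ q` and `y ∙ q` lie in `P′`, and their product is `x ∙ y` because `q` is
    -- a central involution.
    L-index₂ : ∀ {x y} → P x → ¬ L x → P y → ¬ L y → L (x ∙ y)
    L-index₂ {x} {y} x∈ x∉ y∈ y∉ =
      ∙∈ subP x∈ y∈ , subst P′ (xqyq≡xy x y) (∙∈ subP′ (xq∈P′ x∈ x∉) (xq∈P′ y∈ y∉))

    K-index₂ : ∀ {x y} → ¬ K x → ¬ K y → K (x ∙ y)
    K-index₂ {x} {y} x∉ y∉ with P∪Pq x | P∪Pq y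
    ... | inj₁ x∈  | inj₁ y∈  = inj₁ (L-index₂ x∈ (x∉ ∘ inj₁) y∈ (y∉ ∘ inj₁))
    ... | inj₁ x∈  | inj₂ yq∈ = inj₂ (subst L (sym (assoc x y q)) (L-index₂ x∈ (x∉ ∘ inj₁) yq∈ (y∉ ∘ inj₂)))
    ... | inj₂ xq∈ | inj₁ y∈  = inj₂ (subst L (sym (xyq≡xqy x y)) (L-index₂ xq∈ (x∉ ∘ inj₂) y∈ (y∉ ∘ inj₁)))
    ... | inj₂ xq∈ | inj₂ yq∈ = inj₁ (subst L (xqyq≡xy x y) (L-index₂ xq∈ (x∉ ∘ inj₂) yq∈ (y∉ ∘ inj₂)))

    S-on-P∖L : ∀ {x} → P x → ¬ L x → S x ≡ true
    S-on-P∖L {x} x∈ x∉L = ∉⇒S≡true (λ { refl → x∉L (ε∈ sL) }) (λ x∈P′ → x∉L (x∈ , x∈P′)) x∉Q′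
      where
      x∉Q′ : ¬ Q′ x
      x∉Q′ x∈Q′ with Q′-elements x∈Q′
      ... | inj₁ refl = x∉L (ε∈ sL)
      ... | inj₂ refl = q∉P (cancelˡ∈ subP u∈P x∈)

    S-off-P : ∀ {x} → ¬ K x → ¬ P x → S x ≡ false
    S-off-P {x} x∉K x∉P = ∉⇒S≡false (λ { refl → x∉P (ε∈ subP) }) x∉P x∉Q
      where
      x∉Q : ¬ Q x
      x∉Q x∈Q with Q-elements x∈Q
      ... | inj₁ refl = x∉P (ε∈ subP)
      ... | inj₂ refl = x∉K (inj₂ (subst L (sym qq≡ε) (ε∈ sL)))

    u∈K : K u
    u∈K = inj₁ (u∈P , u∈P′)

    -- Off `K`, `S` is the indicator of `P`. Multiplication by `u` changes membership neither in `P`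
    -- nor in `K`.
    S-inv : ∀ {x} → ¬ K x → S (x ∙ u) ≡ S x
    S-inv {x} x∉ with mem? subP x
    ... | yes x∈ = trans (S-on-P∖L (∙∈ subP x∈ u∈P) (xu∉ ∘ inj₁)) (sym (S-on-P∖L x∈ (x∉ ∘ inj₁)))
      where
      xu∉ : ¬ K (x ∙ u)
      xu∉ = x∉ ∘ cancelʳ∈ sK u∈K
    ... | no x∉P = trans (S-off-P (x∉ ∘ cancelʳ∈ sK u∈K) (x∉P ∘ cancelʳ∈ subP u∈P)) (sym (S-off-P x∉ x∉P))

    -- The shear forces `K` to be the whole group, and an element of `P` with `x ∙ q` in `L` would
    -- put `q` into `P`.
    P⊆L : ∀ {x} → P x → L x
    P⊆L {x} x∈ with Shear.shear-trivial autS sK u≢ε uu≡ε u∈K u-central K-index₂ S-inv x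
    ... | inj₁ x∈L  = x∈L
    ... | inj₂ xq∈L = contradiction (cancelˡ∈ subP x∈ (proj₁ xq∈L)) q∉P

    P-elements : ∀ {x} → P x → x ≡ ε ⊎ x ≡ u
    P-elements {x} x∈ with x ≟ ε
    ... | yes x≡ε = inj₁ x≡ε
    ... | no  x≢ε = inj₂ (P∩P′-unique x∈ (proj₂ (P⊆L x∈)) x≢ε)

    elements : ∀ x → x ≡ ε ⊎ x ≡ u ⊎ x ≡ q ⊎ x ≡ u ∙ q
    elements x with P∪Pq x
    ... | inj₁ x∈ = [ inj₁ , inj₂ ∘ inj₁ ]′ (P-elements x∈)
    ... | inj₂ xq∈ with P-elements xq∈
    ...   | inj₁ xq≡ε = inj₂ (inj₂ (inj₁ (trans (inverseˡ-unique x q xq≡ε) (sym (inverseˡ-unique q q qq≡ε)))))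
    ...   | inj₂ xq≡u = inj₂ (inj₂ (inj₂ (trans (sym (xqq≡x x)) (cong (_∙ q) xq≡u))))

    S-q : S q ≡ true
    S-q = ∉⇒S≡true q≢ε q∉P′ q∉Q′

    S-uq : S (u ∙ q) ≡ false
    S-uq = ∉⇒S≡false uq≢ε (q∉P ∘ cancelˡ∈ subP u∈P) (λ uq∈Q → u≢ε (disjoint u∈P (cancelʳ∈ subQ q∈Q uq∈Q)))

    u≢q : u ≢ q
    u≢q u≡q = q∉P (subst P u≡q u∈P)

    -- In the Klein four-group on `u` and `q`, `S` takes different values at `q` and `u ∙ q`. So
    -- `S u` agrees with one of these, and `klein-four` applies to `u` and that element.
    impossible : ⊥
    impossible with S u in Su
    ... | true  = klein-four autS uq≡qu uu≡ε qq≡ε u≢ε q≢ε u≢q elements (trans Su (sym S-q))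
    ... | false = klein-four autS (u-central′) uu≡ε uquq≡ε u≢ε uq≢ε u≢uq elements′ (trans Su (sym S-uq))
      where
      u-central′ : u ∙ (u ∙ q) ≡ u ∙ q ∙ u
      u-central′ = u-central (u ∙ q)
      uquq≡ε : u ∙ q ∙ (u ∙ q) ≡ ε
      uquq≡ε = trans (xqyq≡xy u u) uu≡ε
      u≢uq : u ≢ u ∙ q
      u≢uq u≡uq = q≢ε (x∙y≡x⇒y≡ε (sym u≡uq))
      uuq≡q : u ∙ (u ∙ q) ≡ q
      uuq≡q = trans (sym (assoc u u q)) (trans (cong (_∙ q) uu≡ε) (identityˡ q))
      elements′ : ∀ x → x ≡ ε ⊎ x ≡ u ⊎ x ≡ u ∙ q ⊎ x ≡ u ∙ (u ∙ q)
      elements′ x with elements x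
      ... | inj₁ e               = inj₁ e
      ... | inj₂ (inj₁ e)        = inj₂ (inj₁ e)
      ... | inj₂ (inj₂ (inj₁ e)) = inj₂ (inj₂ (inj₂ (trans e (sym uuq≡q))))
      ... | inj₂ (inj₂ (inj₂ e)) = inj₂ (inj₂ (inj₁ e))

  -- The case of trivial intersections.

  record Transversal (P Q P′ Q′ : Pred C 0ℓ) : Set where
    field
      P∩P′ : ∀ {x} → P x → P′ x → x ≡ ε
      P∩Q′ : ∀ {x} → P x → Q′ x → x ≡ ε
      Q∩P′ : ∀ {x} → Q x → P′ x → x ≡ ε
      Q∩Q′ : ∀ {x} → Q x → Q′ x → x ≡ ε

  transversal-flipˡ : ∀ {P Q P′ Q′} → Transversal P Q P′ Q′ → Transversal Q P P′ Q′
  transversal-flipˡ t = record { P∩P′ = Q∩P′ ; P∩Q′ = Q∩Q′ ; Q∩P′ = P∩P′ ; Q∩Q′ = P∩Q′ }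
    where open Transversal t

  transversal-flipʳ : ∀ {P Q P′ Q′} → Transversal P Q P′ Q′ → Transversal P Q Q′ P′
  transversal-flipʳ t = record { P∩P′ = P∩Q′ ; P∩Q′ = P∩P′ ; Q∩P′ = Q∩Q′ ; Q∩Q′ = Q∩P′ }
    where open Transversal t

  module TransversalCovers {S P Q P′ Q′} (c : Configuration S P Q P′ Q′) (t : Transversal P Q P′ Q′) where
    open Configuration c
    open Transversal t

    -- The quotient of `x ∙ z` by `x ∙ y` is that of `z` by `y`, so it lies in both `P′` and `Q`.
    same-P′ : ∀ {x y z} → P′ (x ∙ y) → P′ (x ∙ z) → Q y → Q z → y ≡ z
    same-P′ {x} {y} {z} xy∈ xz∈ y∈ z∈ = ⁻¹-injective (inverseˡ-unique _ _ (Q∩P′ (∙∈ subQ (⁻¹∈ subQ y∈) z∈)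
      (cancelˡ∈ subP′ xy∈ (subst P′ (sym (trans (assoc x y (y \\ z)) (cong (x ∙_) (\\-leftDividesˡ y z)))) xz∈))))

    -- `H` contains `x ∙ y`, a nontrivial element of `P′`. Its product with a nontrivial `w` of `Q′`
    -- falls into `P` or `Q` by `cross`, so `w` is in `H`. The same argument with such a `w`
    -- captures `P′`.
    generated-by : ∀ {H x y} → Subgroup H → (∀ {z} → P z → H z) → (∀ {z} → Q z → H z) →
      P x → Q y → x ∙ y ≢ ε → P′ (x ∙ y) → ∀ z → H z
    generated-by {H} {x} {y} sH P⊆H Q⊆H x∈ y∈ xy≢ε xy∈P′ z = [ [ P⊆H , Q⊆H ]′ , [ P′⊆H , Q′⊆H ]′ ]′ (cover-all z)
      where
      P′Q′⊆H : ∀ {v w} → P′ v → v ≢ ε → Q′ w → w ≢ ε → H (v ∙ w)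
      P′Q′⊆H v∈ v≢ε w∈ w≢ε = [ P⊆H , Q⊆H ]′ (Configuration.cross (dual c) v∈ v≢ε w∈ w≢ε)
      Q′⊆H : ∀ {w} → Q′ w → H w
      Q′⊆H {w} w∈ with w ≟ ε
      ... | yes refl = ε∈ sH
      ... | no  w≢ε  = cancelˡ∈ sH (∙∈ sH (P⊆H x∈) (Q⊆H y∈)) (P′Q′⊆H xy∈P′ xy≢ε w∈ w≢ε)
      P′⊆H : ∀ {v} → P′ v → H v
      P′⊆H {v} v∈ with v ≟ ε | Q-nontrivial (dual c)
      ... | yes refl | _              = ε∈ sH
      ... | no  v≢ε  | w , w∈ , w≢ε = cancelʳ∈ sH (Q′⊆H w∈) (P′Q′⊆H v∈ v≢ε w∈ w≢ε)

  module TransversalGeneration {S P Q P′ Q′} (c : Configuration S P Q P′ Q′) (t : Transversal P Q P′ Q′) where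
    open Configuration c
    open TransversalCovers c t
    open TransversalCovers (flipʳ c) (transversal-flipʳ t) using ()
      renaming (same-P′ to same-Q′; generated-by to generated-by′)

    p : C
    p = proj₁ (Q-nontrivial (flipˡ c))
    p∈P : P p
    p∈P = proj₁ (proj₂ (Q-nontrivial (flipˡ c)))
    p≢ε : p ≢ ε
    p≢ε = proj₂ (proj₂ (Q-nontrivial (flipˡ c)))

    generates : ∀ {H} → Subgroup H → (∀ {z} → P z → H z) → (∀ {z} → Q z → H z) → ∀ z → H z
    generates sH P⊆H Q⊆H with Q-nontrivial c
    ... | q , q∈ , q≢ε with cross p∈P p≢ε q∈ q≢ε
    ...   | inj₁ pq∈P′ = generated-by sH P⊆H Q⊆H p∈P q∈ pq≢ε pq∈P′
      where
      pq≢ε : p ∙ q ≢ ε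
      pq≢ε pq≡ε = q≢ε (disjoint (cancelˡ∈ subP p∈P (subst P (sym pq≡ε) (ε∈ subP))) q∈)
    ...   | inj₂ pq∈Q′ = generated-by′ sH P⊆H Q⊆H p∈P q∈ pq≢ε pq∈Q′
      where
      pq≢ε : p ∙ q ≢ ε
      pq≢ε pq≡ε = q≢ε (disjoint (cancelˡ∈ subP p∈P (subst P (sym pq≡ε) (ε∈ subP))) q∈)

    opposite-commute : ∀ {y z} → Q y → Q z → p ∙ y ∙ (p ∙ z) ≡ p ∙ z ∙ (p ∙ y) → y ∙ z ≡ z ∙ y
    opposite-commute {y} {z} y∈ z∈ e = ∙-cancelˡ p _ _ (∙-cancelˡ p _ _ (begin
        p ∙ (p ∙ (y ∙ z)) ≡⟨ sym (expand y∈) ⟩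
        p ∙ y ∙ (p ∙ z)   ≡⟨ e ⟩
        p ∙ z ∙ (p ∙ y)   ≡⟨ expand z∈ ⟩
        p ∙ (p ∙ (z ∙ y)) ∎))
      where
      open ≡-Reasoning
      expand : ∀ {v w} → Q v → p ∙ v ∙ (p ∙ w) ≡ p ∙ (p ∙ (v ∙ w))
      expand {v} {w} v∈ = begin
        p ∙ v ∙ (p ∙ w)   ≡⟨ sym (assoc (p ∙ v) p w) ⟩
        p ∙ v ∙ p ∙ w     ≡⟨ cong (_∙ w) (assoc p v p) ⟩
        p ∙ (v ∙ p) ∙ w   ≡⟨ cong (λ s → p ∙ s ∙ w) (sym (commute p∈P v∈)) ⟩
        p ∙ (p ∙ v) ∙ w   ≡⟨ assoc p (p ∙ v) w ⟩
        p ∙ (p ∙ v ∙ w)   ≡⟨ cong (p ∙_) (assoc p v w) ⟩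
        p ∙ (p ∙ (v ∙ w)) ∎

    -- Unless y = z, one of p y and p z lies in P′ and the other in Q′, so they commute.
    Q-abelian : ∀ {y z} → Q y → Q z → y ∙ z ≡ z ∙ y
    Q-abelian {y} {z} y∈ z∈ with y ≟ ε | z ≟ ε
    ... | yes refl | _        = trans (identityˡ z) (sym (identityʳ z))
    ... | no _     | yes refl = trans (identityʳ y) (sym (identityˡ y))
    ... | no y≢ε   | no z≢ε   with cross p∈P p≢ε y∈ y≢ε | cross p∈P p≢ε z∈ z≢ε
    ...   | inj₁ py∈ | inj₁ pz∈ = cong₂ _∙_ y≡z (sym y≡z) where y≡z = same-P′ py∈ pz∈ y∈ z∈
    ...   | inj₂ py∈ | inj₂ pz∈ = cong₂ _∙_ y≡z (sym y≡z) where y≡z = same-Q′ py∈ pz∈ y∈ z∈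
    ...   | inj₁ py∈ | inj₂ pz∈ = opposite-commute y∈ z∈ (commute′ py∈ pz∈)
    ...   | inj₂ py∈ | inj₁ pz∈ = opposite-commute y∈ z∈ (sym (commute′ pz∈ py∈))

  centraliser : ∀ x → Subgroup (λ y → x ∙ y ≡ y ∙ x)
  centraliser x = record
    { mem? = λ y → x ∙ y ≟ y ∙ x
    ; ε∈   = trans (identityʳ x) (sym (identityˡ x))
    ; ∙∈   = λ {y} {z} xy≡yx xz≡zx → begin
        x ∙ (y ∙ z) ≡⟨ sym (assoc x y z) ⟩
        x ∙ y ∙ z   ≡⟨ cong (_∙ z) xy≡yx ⟩
        y ∙ x ∙ z   ≡⟨ assoc y x z ⟩
        y ∙ (x ∙ z) ≡⟨ cong (y ∙_) xz≡zx ⟩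
        y ∙ (z ∙ x) ≡⟨ sym (assoc y z x) ⟩
        y ∙ z ∙ x   ∎
    ; ⁻¹∈  = λ {y} xy≡yx → ∙-cancelˡ y _ _ (begin
        y ∙ (x ∙ y ⁻¹)   ≡⟨ sym (assoc y x (y ⁻¹)) ⟩
        y ∙ x ∙ y ⁻¹     ≡⟨ cong (_∙ y ⁻¹) (sym xy≡yx) ⟩
        x ∙ y ∙ y ⁻¹     ≡⟨ //-rightDividesʳ y x ⟩
        x                ≡⟨ sym (\\-leftDividesˡ y x) ⟩
        y ∙ (y ⁻¹ ∙ x)   ∎) }
    where open ≡-Reasoning

  module TransversalAbelian {S P Q P′ Q′} (c : Configuration S P Q P′ Q′) (t : Transversal P Q P′ Q′) where
    open Configuration c
    open Transversal t
    open TransversalGeneration c t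
    open TransversalGeneration (flipˡ c) (transversal-flipˡ t) using () renaming (Q-abelian to P-abelian)

    -- `generates` is applied twice: centralisers of elements of `P` and `Q` contain both subgroups,
    -- so these elements are central; then every centraliser contains both subgroups.
    abelian : ∀ x y → x ∙ y ≡ y ∙ x
    abelian x = generates (centraliser x) (λ {y} y∈ → sym (P-central y∈ x)) (λ {y} y∈ → sym (Q-central y∈ x))
      where
      P-central : ∀ {y} → P y → ∀ z → y ∙ z ≡ z ∙ y
      P-central {y} y∈ = generates (centraliser y) (P-abelian y∈) (commute y∈)
      Q-central : ∀ {y} → Q y → ∀ z → y ∙ z ≡ z ∙ y
      Q-central {y} y∈ = generates (centraliser y) (λ z∈ → sym (commute z∈ y∈)) (Q-abelian y∈)

    -- Trivial intersections determine `S` off `ε`: true on `P` and `Q`, false on `P′` and `Q′`.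
    -- Each of these is closed under inverses.
    S-⁻¹ : ∀ x → x ≢ ε → S (x ⁻¹) ≡ S x
    S-⁻¹ x x≢ε with cover-all x
    ... | inj₁ (inj₁ x∈) = trans (S≡true (⁻¹∈ subP x∈) (⁻¹-≢ε x≢ε)) (sym (S≡true x∈ x≢ε))
      where
      S≡true : ∀ {y} → P y → y ≢ ε → S y ≡ true
      S≡true y∈ y≢ε = ∉⇒S≡true y≢ε (λ y∈P′ → y≢ε (P∩P′ y∈ y∈P′)) (λ y∈Q′ → y≢ε (P∩Q′ y∈ y∈Q′))
    ... | inj₁ (inj₂ x∈) = trans (S≡true (⁻¹∈ subQ x∈) (⁻¹-≢ε x≢ε)) (sym (S≡true x∈ x≢ε))
      where
      S≡true : ∀ {y} → Q y → y ≢ ε → S y ≡ true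
      S≡true y∈ y≢ε = ∉⇒S≡true y≢ε (λ y∈P′ → y≢ε (Q∩P′ y∈ y∈P′)) (λ y∈Q′ → y≢ε (Q∩Q′ y∈ y∈Q′))
    ... | inj₂ (inj₁ x∈) = trans (S≡false (⁻¹∈ subP′ x∈) (⁻¹-≢ε x≢ε)) (sym (S≡false x∈ x≢ε))
      where
      S≡false : ∀ {y} → P′ y → y ≢ ε → S y ≡ false
      S≡false y∈ y≢ε = ∉⇒S≡false y≢ε (λ y∈P → y≢ε (P∩P′ y∈P y∈)) (λ y∈Q → y≢ε (Q∩P′ y∈Q y∈))
    ... | inj₂ (inj₂ x∈) = trans (S≡false (⁻¹∈ subQ′ x∈) (⁻¹-≢ε x≢ε)) (sym (S≡false x∈ x≢ε))
      where
      S≡false : ∀ {y} → Q′ y → y ≢ ε → S y ≡ false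
      S≡false y∈ y≢ε = ∉⇒S≡false y≢ε (λ y∈P → y≢ε (P∩Q′ y∈P y∈)) (λ y∈Q → y≢ε (Q∩Q′ y∈Q y∈))

    involution : ∀ x → x ∙ x ≡ ε
    involution x = trans (cong (_∙ x) (sym (autS _⁻¹ inversion-aut S-⁻¹ x))) (inverseˡ x)
      where
      inversion-aut : IsGroupAut G _⁻¹
      inversion-aut = (λ y z → trans (⁻¹-anti-homo-∙ y z) (abelian (z ⁻¹) (y ⁻¹)))
                    , _⁻¹ , ⁻¹-involutive , ⁻¹-involutive

  module TransversalProducts {S P Q P′ Q′} (c : Configuration S P Q P′ Q′) (t : Transversal P Q P′ Q′) where
    open Configuration c
    open Transversal t
    open TransversalCovers c t
    open TransversalCovers (flipʳ c) (transversal-flipʳ t) using () renaming (same-P′ to same-Q′)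
    open TransversalAbelian c t

    -- Two of x y, x z, x (z y) lie in a common factor P′ or Q′.
    klein-impossible : ∀ {x y z} → P x → x ≢ ε → Q y → y ≢ ε → Q z → z ≢ ε → y ≢ z →
      P′ (x ∙ y) → ¬ Q′ (x ∙ (z ∙ y))
    klein-impossible {x} {y} {z} x∈ x≢ε y∈ y≢ε z∈ z≢ε y≢z xy∈P′ xzy∈Q′ with cross x∈ x≢ε z∈ z≢ε
    ... | inj₁ xz∈P′ = y≢z (same-P′ xy∈P′ xz∈P′ y∈ z∈)
    ... | inj₂ xz∈Q′ = y≢ε (x∙y≡x⇒y≡ε (sym (same-Q′ xz∈Q′ xzy∈Q′ z∈ (∙∈ subQ z∈ y∈))))

    -- If `z`, that is `x ∙ y ∙ r`, were in `Q`, then `x ∙ (z ∙ y)` would equal `r` because the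
    -- group is abelian of exponent 2. This contradicts `klein-impossible`, once `z` is known to
    -- differ from `ε` and `y`.
    Q-product : ∀ {x y r} → P x → x ≢ ε → Q y → y ≢ ε → P′ (x ∙ y) → Q′ r → r ≢ ε → ¬ Q (x ∙ y ∙ r)
    Q-product {x} {y} {r} x∈ x≢ε y∈ y≢ε xy∈ r∈ r≢ε z∈ = klein-impossible x∈ x≢ε y∈ y≢ε z∈ z≢ε y≢z xy∈
        (subst Q′ (sym xzy≡r) r∈)
      where
      z = x ∙ y ∙ r
      xyz≡r : x ∙ y ∙ z ≡ r
      xyz≡r = trans (sym (assoc (x ∙ y) (x ∙ y) r)) (trans (cong (_∙ r) (involution (x ∙ y))) (identityˡ r))
      xzy≡r : x ∙ (z ∙ y) ≡ r
      xzy≡r = trans (cong (x ∙_) (abelian z y)) (trans (sym (assoc x y z)) xyz≡r)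
      z≢ε : z ≢ ε
      z≢ε z≡ε = r≢ε (disjoint′ (subst P′ (trans (inverseˡ-unique (x ∙ y) r z≡ε)
        (sym (inverseˡ-unique r r (involution r)))) xy∈) r∈)
      y≢z : y ≢ z
      y≢z y≡z = r≢ε (P∩Q′ (subst P (trans (sym (identityʳ x)) (trans (cong (x ∙_) (sym (involution y)))
        (trans (sym (assoc x y y)) (trans (cong (x ∙ y ∙_) y≡z) xyz≡r)))) x∈) r∈)

  module TransversalElimination {S P Q P′ Q′} (c : Configuration S P Q P′ Q′) (t : Transversal P Q P′ Q′) where
    open Configuration c
    open TransversalProducts c t
    open TransversalProducts (flipˡ c) (transversal-flipˡ t) using () renaming (Q-product to P-product)

    -- For a nontrivial `r` in `Q′`, `cross` puts `x ∙ y ∙ r` into `P` or `Q`, and `Q-product` with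
    -- its mirror image excludes both.
    xy∉P′ : ∀ {x y} → P x → x ≢ ε → Q y → y ≢ ε → ¬ P′ (x ∙ y)
    xy∉P′ {x} {y} x∈ x≢ε y∈ y≢ε xy∈ with Q-nontrivial (dual c)
    ... | r , r∈ , r≢ε with Configuration.cross (dual c) xy∈ xy≢ε r∈ r≢ε
      where
      xy≢ε : x ∙ y ≢ ε
      xy≢ε xy≡ε = y≢ε (disjoint (cancelˡ∈ subP x∈ (subst P (sym xy≡ε) (ε∈ subP))) y∈)
    ... | inj₂ xyr∈Q = Q-product x∈ x≢ε y∈ y≢ε xy∈ r∈ r≢ε xyr∈Q
    ... | inj₁ xyr∈P = P-product y∈ y≢ε x∈ x≢ε (subst P′ xy≡yx xy∈) r∈ r≢ε (subst P (cong (_∙ r) xy≡yx) xyr∈P)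
      where
      xy≡yx : x ∙ y ≡ y ∙ x
      xy≡yx = commute x∈ y∈

  transversal-impossible : ∀ {S P Q P′ Q′} → Configuration S P Q P′ Q′ → ¬ Transversal P Q P′ Q′
  transversal-impossible c t with Q-nontrivial (flipˡ c) | Q-nontrivial c
  ... | p , p∈ , p≢ε | q , q∈ , q≢ε with Configuration.cross c p∈ p≢ε q∈ q≢ε
  ...   | inj₁ pq∈P′ = TransversalElimination.xy∉P′ c t p∈ p≢ε q∈ q≢ε pq∈P′
  ...   | inj₂ pq∈Q′ = TransversalElimination.xy∉P′ (flipʳ c) (transversal-flipʳ t) p∈ p≢ε q∈ q≢ε pq∈Q′

  configuration-impossible : ∀ {S P Q P′ Q′} → ¬ Configuration S P Q P′ Q′
  configuration-impossible c = transversal-impossible c record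
    { P∩P′ = meet c ; P∩Q′ = meet (flipʳ c) ; Q∩P′ = meet (flipˡ c) ; Q∩Q′ = meet (flipˡ (flipʳ c)) }
    where
    meet : ∀ {S P Q P′ Q′} → Configuration S P Q P′ Q′ → ∀ {x} → P x → P′ x → x ≡ ε
    meet c {x} x∈P x∈P′ = decidable-stable (x ≟ ε) (λ x≢ε → SharedElementElimination.impossible c x≢ε x∈P x∈P′)

  not-both-decomposable : ∀ {S} → AutTrivial S → Decomposable S → ¬ Decomposable (not ∘ S)
  not-both-decomposable autS (_ , _ , pair , cover) (_ , _ , pair′ , cover′) = configuration-impossible
    record { autS = autS ; pair = pair ; pair′ = pair′ ; cover = cover ; cover′ = cover′ }

-- Regular representations and rigid connection sets.

isDRR⇒fixed-point-free : ∀ G {V E} → IsDRR G V E → ∀ {σ v} → IsDigraphAut E σ → σ v ≡ v → ∀ x → σ x ≡ x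
isDRR⇒fixed-point-free G (ρ , ρ-aut , ρ-∙ , _ , ρ-onto , _ , ρ-free) {σ} {v} σ-aut σv≡v x
  with ρ-onto σ σ-aut
... | g , σ≡ρg with ρ-free g v (trans (sym (σ≡ρg v)) σv≡v)
-- `ρ ε` is idempotent and invertible, hence the identity.
...   | refl = trans (σ≡ρg x) (begin
        ρ ε x             ≡⟨ sym (τρ≡id (ρ ε x)) ⟩
        τ (ρ ε (ρ ε x))   ≡⟨ cong τ (sym (ρ-∙ ε ε x)) ⟩
        τ (ρ (ε ∙ ε) x)   ≡⟨ cong (λ g → τ (ρ g x)) (identityˡ ε) ⟩
        τ (ρ ε x)         ≡⟨ τρ≡id x ⟩
        x                 ∎)
      where
      open FiniteGroup G
      open ≡-Reasoning
      τ = proj₁ (proj₁ (ρ-aut ε))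
      τρ≡id = proj₁ (proj₂ (proj₁ (ρ-aut ε)))

module CayleyRigidity (G : FinGroup) where
  open FiniteGroup G public

  -- Restricting to distinct pairs ignores loops, in accordance with `AutTrivial`.
  CayAut : (C → Bool) → (C → C) → Set
  CayAut S σ = (Σ (C → C) λ τ → (∀ x → τ (σ x) ≡ x) × (∀ x → σ (τ x) ≡ x))
             × (∀ {x y} → x ≢ y → S (σ y // σ x) ≡ S (y // x))

  -- Triviality of the stabiliser of `ε`. Right multiplications being transitive, this expresses
  -- that the Cayley digraph is a DRR.
  Rigid : (C → Bool) → Set
  Rigid S = ∀ {σ} → CayAut S σ → σ ε ≡ ε → ∀ x → σ x ≡ x

  cay⇔ : ∀ {S x y} → Cay G S x y ⇔ S (y // x) ≡ true
  cay⇔ {S} {x} {y} = mk⇔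
    (λ { (s , Ss , refl) → trans (cong S (//-rightDividesʳ x s)) Ss })
    (λ Sy//x → y // x , Sy//x , sym (//-rightDividesˡ x y))

  cayAut⇒digraphAut : ∀ {S σ} → CayAut S σ → IsDigraphAut (Cay G S) σ
  cayAut⇒digraphAut {S} {σ} (inv , σ-S) = inv , λ x y → mk⇔
    (λ xy → Equivalence.from (cay⇔ {S}) (trans (σ-S′ x y) (Equivalence.to (cay⇔ {S}) xy)))
    (λ xy → Equivalence.from (cay⇔ {S}) (trans (sym (σ-S′ x y)) (Equivalence.to (cay⇔ {S}) xy)))
    where
    σ-S′ : ∀ x y → S (σ y // σ x) ≡ S (y // x)
    σ-S′ x y with x ≟ y
    ... | yes refl = cong S (trans (inverseʳ (σ x)) (sym (inverseʳ x)))
    ... | no  x≢y  = σ-S x≢y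

  digraphAut⇒cayAut : ∀ {S σ} → IsDigraphAut (Cay G S) σ → CayAut S σ
  digraphAut⇒cayAut {S} (inv , σ-E) = inv , λ {x} {y} _ → ⇔→≡ {z = true} (mk⇔
    (Equivalence.to (cay⇔ {S}) ∘ Equivalence.from (σ-E x y) ∘ Equivalence.from (cay⇔ {S}))
    (Equivalence.to (cay⇔ {S}) ∘ Equivalence.to (σ-E x y) ∘ Equivalence.from (cay⇔ {S})))

  isDRR⇒rigid : ∀ {S} → IsDRR G C (Cay G S) → Rigid S
  isDRR⇒rigid {S} drr σ-aut = isDRR⇒fixed-point-free G drr (cayAut⇒digraphAut {S} σ-aut)

  rightMul-cancel : ∀ x y g → (y ∙ g) // (x ∙ g) ≡ y // x
  rightMul-cancel x y g = begin
    y ∙ g ∙ (x ∙ g) ⁻¹     ≡⟨ cong (y ∙ g ∙_) (⁻¹-anti-homo-∙ x g) ⟩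
    y ∙ g ∙ (g ⁻¹ ∙ x ⁻¹)  ≡⟨ sym (assoc (y ∙ g) (g ⁻¹) (x ⁻¹)) ⟩
    y ∙ g ∙ g ⁻¹ ∙ x ⁻¹    ≡⟨ cong (_∙ x ⁻¹) (//-rightDividesʳ g y) ⟩
    y ∙ x ⁻¹               ∎
    where open ≡-Reasoning

  rightMul-cayAut : ∀ {S} g → CayAut S (_∙ g)
  rightMul-cayAut {S} g = (_// g , //-rightDividesʳ g , //-rightDividesˡ g)
                        , λ {x} {y} _ → cong S (rightMul-cancel x y g)

  cayAut-∘ : ∀ {S σ σ′} → CayAut S σ → CayAut S σ′ → CayAut S (σ ∘ σ′)
  cayAut-∘ {S} {σ} {σ′} ((τ , τσ , στ) , σ-S) ((τ′ , τσ′ , στ′) , σ-S′) =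
    (τ′ ∘ τ , (λ x → trans (cong τ′ (τσ (σ′ x))) (τσ′ x)) , (λ x → trans (cong σ (στ′ (τ x))) (στ x)))
    , λ x≢y → trans (σ-S (λ e → x≢y (trans (sym (τσ′ _)) (trans (cong τ′ e) (τσ′ _))))) (σ-S′ x≢y)

  rigid⇒isDRR : ∀ {S} → Rigid S → IsDRR G C (Cay G S)
  rigid⇒isDRR {S} rigid =
    ρ , (λ g → cayAut⇒digraphAut (rightMul-cayAut {S} (g ⁻¹))) , ρ-∙ , ρ-injective , ρ-onto , ρ-transitive , ρ-free
    where
    ρ : C → C → C
    -- The inverse turns right multiplication into a left action.
    ρ g x = x // g
    ρ-∙ : ∀ g h x → x // (g ∙ h) ≡ (x // h) // g
    ρ-∙ g h x = trans (cong (x ∙_) (⁻¹-anti-homo-∙ g h)) (sym (assoc x (h ⁻¹) (g ⁻¹)))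
    ρ-injective : ∀ g h → (∀ x → x // g ≡ x // h) → g ≡ h
    ρ-injective g h e = ⁻¹-injective (∙-cancelˡ ε _ _ (e ε))
    ρ-onto : ∀ σ → IsDigraphAut (Cay G S) σ → Σ C λ g → ∀ x → σ x ≡ x // g
    -- Following `σ` by right division by `σ ε` gives an automorphism fixing `ε`, so `σ` is right
    -- multiplication by `σ ε`.
    ρ-onto σ σ-aut = σ ε ⁻¹ , λ x → begin
      σ x                        ≡⟨ sym (//-rightDividesˡ (σ ε) (σ x)) ⟩
      (σ x // σ ε) ∙ σ ε         ≡⟨ cong (_∙ σ ε) (rigid
        (cayAut-∘ {S} (rightMul-cayAut {S} (σ ε ⁻¹)) (digraphAut⇒cayAut {S} σ-aut)) (inverseʳ (σ ε)) x) ⟩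
      x ∙ σ ε                    ≡⟨ cong (x ∙_) (sym (⁻¹-involutive (σ ε))) ⟩
      x // (σ ε ⁻¹)              ∎
      where open ≡-Reasoning
    ρ-transitive : ∀ u v → Σ C λ g → u // g ≡ v
    ρ-transitive u v = v \\ u , (begin
      u ∙ (v ⁻¹ ∙ u) ⁻¹     ≡⟨ cong (u ∙_) (⁻¹-anti-homo-\\ v u) ⟩
      u ∙ (u ⁻¹ ∙ v)        ≡⟨ \\-leftDividesˡ u v ⟩
      v                     ∎)
      where open ≡-Reasoning
    ρ-free : ∀ g u → u // g ≡ u → g ≡ ε
    ρ-free g u e = ⁻¹-injective (trans (x∙y≡x⇒y≡ε e) (sym ε⁻¹≈ε))

  group-aut-ε : ∀ {φ} → IsGroupAut G φ → φ ε ≡ ε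
  group-aut-ε {φ} (φ-∙ , _) = x∙y≡x⇒y≡ε (trans (sym (φ-∙ ε ε)) (cong φ (identityˡ ε)))

  group-aut-// : ∀ {φ} → IsGroupAut G φ → ∀ x y → φ (y // x) ≡ φ y // φ x
  group-aut-// {φ} (φ-∙ , _) x y =
    x≈z//y (φ (y // x)) (φ x) (φ y) (trans (sym (φ-∙ (y // x) x)) (cong φ (//-rightDividesˡ x y)))

  rigid⇒autTrivial : ∀ {S} → Rigid S → AutTrivial S
  rigid⇒autTrivial {S} rigid φ φ-aut φ-S = rigid
    (proj₂ φ-aut , λ {x} {y} x≢y → trans (cong S (sym (group-aut-// φ-aut x y)))
      (φ-S (y // x) (λ e → x≢y (sym (x∙y⁻¹≈ε⇒x≈y y x e)))))
    (group-aut-ε φ-aut)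

  autTrivial⇒autGSTrivial : ∀ {S} → AutTrivial S → AutGSTrivial G S
  autTrivial⇒autGSTrivial t φ φ-aut φ-S = t φ φ-aut (λ x _ → φ-S x)

  autGSTrivial⇒autTrivial : ∀ {S} → AutGSTrivial G S → AutTrivial S
  autGSTrivial⇒autTrivial {S} t φ φ-aut φ-S = t φ φ-aut φ-S′
    where
    φ-S′ : ∀ x → S (φ x) ≡ S x
    φ-S′ x with x ≟ ε
    ... | yes refl = cong S (group-aut-ε φ-aut)
    ... | no  x≢ε  = φ-S x x≢ε

  autTrivial-xor : ∀ b {S} → AutTrivial S → AutTrivial ((b xor_) ∘ S)
  autTrivial-xor false t = t
  autTrivial-xor true {S} t = autTrivial-not {S} t

  cayAut-xor : ∀ b {S σ} → CayAut S σ → CayAut ((b xor_) ∘ S) σ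
  cayAut-xor b (inv , σ-S) = inv , λ x≢y → cong (b xor_) (σ-S x≢y)

  rigid-xor : ∀ b {S} → Rigid S → Rigid ((b xor_) ∘ S)
  rigid-xor false rigid = rigid
  rigid-xor true {S} rigid (inv , σ-S) = rigid (inv , λ x≢y → not-injective (σ-S x≢y))

  inverseClosed-⁻¹ : ∀ {S} → InverseClosed G S → ∀ x → S (x ⁻¹) ≡ S x
  inverseClosed-⁻¹ {S} closed x = ⇔→≡ {z = true} (mk⇔
    (λ Sx⁻¹ → trans (cong S (sym (⁻¹-involutive x))) (closed (x ⁻¹) Sx⁻¹)) (closed x))

  inverseClosed-xor : ∀ b {S} → InverseClosed G S → InverseClosed G ((b xor_) ∘ S)
  inverseClosed-xor b closed x Sx = trans (cong (b xor_) (inverseClosed-⁻¹ closed x)) Sx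

  -- A double-negated existence statement, since decomposability quantifies over predicates and is
  -- not decided.
  some-indecomposable : ∀ {S} → AutTrivial S → ¬ (∀ b → ¬ ¬ Decomposable ((b xor_) ∘ S))
  some-indecomposable autS d = d false (λ d₁ → d true (not-both-decomposable autS d₁))

  inverseClosed⇒isGraph : ∀ {S} → InverseClosed G S → IsGraph (Cay G S)
  inverseClosed⇒isGraph {S} closed x y xy = Equivalence.from (cay⇔ {S})
    (trans (cong S (sym (⁻¹-anti-homo-// y x))) (closed (y // x) (Equivalence.to (cay⇔ {S}) xy)))

  -- Regularity identifies the vertices with G, so that the given digraph becomes a Cayley digraph.
  module Connection {V : Set} (E : V → V → Bool) (drr : IsDRR G V (λ u v → E u v ≡ true)) (v₀ : V) where
    ρ = proj₁ drr
    ρ-aut = proj₁ (proj₂ drr)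
    ρ-∙ = proj₁ (proj₂ (proj₂ drr))
    ρ-transitive = proj₁ (proj₂ (proj₂ (proj₂ (proj₂ (proj₂ drr)))))
    ρ-free = proj₂ (proj₂ (proj₂ (proj₂ (proj₂ (proj₂ drr)))))

    ρ-E : ∀ g u v → E (ρ g u) (ρ g v) ≡ E u v
    ρ-E g u v = sym (⇔→≡ {z = true} (proj₂ (ρ-aut g) u v))

    ρ-ε : ∀ v → ρ ε v ≡ v
    ρ-ε v with ρ-transitive v v
    ... | g , ρgv≡v = subst (λ h → ρ h v ≡ v) (ρ-free g v ρgv≡v) ρgv≡v

    -- The inverse makes `ρ g` correspond to right division by `g`, matching edges given by left
    -- multiplication.
    vertex : C → V
    vertex x = ρ (x ⁻¹) v₀

    element : V → C
    element v = proj₁ (ρ-transitive v₀ v) ⁻¹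

    vertex-element : ∀ v → vertex (element v) ≡ v
    vertex-element v = trans (cong (λ g → ρ g v₀) (⁻¹-involutive _)) (proj₂ (ρ-transitive v₀ v))

    vertex-injective : ∀ {x y} → vertex x ≡ vertex y → x ≡ y
    vertex-injective {x} {y} e = sym (x∙y⁻¹≈ε⇒x≈y y x (ρ-free (y // x) v₀ (begin
      ρ (y ∙ x ⁻¹) v₀      ≡⟨ ρ-∙ y (x ⁻¹) v₀ ⟩
      ρ y (vertex x)       ≡⟨ cong (ρ y) e ⟩
      ρ y (ρ (y ⁻¹) v₀)    ≡⟨ sym (ρ-∙ y (y ⁻¹) v₀) ⟩
      ρ (y // y) v₀        ≡⟨ cong (λ g → ρ g v₀) (inverseʳ y) ⟩
      ρ ε v₀               ≡⟨ ρ-ε v₀ ⟩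
      v₀                   ∎)))
      where open ≡-Reasoning

    element-vertex : ∀ x → element (vertex x) ≡ x
    element-vertex x = vertex-injective (vertex-element (vertex x))

    connection : C → Bool
    connection s = E v₀ (vertex s)

    E-connection : ∀ x y → E (vertex x) (vertex y) ≡ connection (y // x)
    E-connection x y = trans (sym (ρ-E x (vertex x) (vertex y))) (cong₂ E
      (trans (sym (ρ-∙ x (x ⁻¹) v₀)) (trans (cong (λ g → ρ g v₀) (inverseʳ x)) (ρ-ε v₀)))
      (trans (sym (ρ-∙ x (y ⁻¹) v₀)) (cong (λ g → ρ g v₀) (sym (⁻¹-anti-homo-// y x)))))

    -- Conjugating by the bijection `vertex` turns `σ` into an automorphism of `E` fixing the vertex
    -- of `ε`.
    connection-rigid : Rigid connection
    connection-rigid {σ} σ-aut@((τ , τσ , στ) , σ-S) σε≡ε x = vertex-injective (begin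
        vertex (σ x)                     ≡⟨ cong (vertex ∘ σ) (sym (element-vertex x)) ⟩
        σ̂ (vertex x)                     ≡⟨ isDRR⇒fixed-point-free G drr σ̂-aut σ̂-fix (vertex x) ⟩
        vertex x                         ∎)
      where
      open ≡-Reasoning
      σ̂ τ̂ : V → V
      σ̂ = vertex ∘ σ ∘ element
      τ̂ = vertex ∘ τ ∘ element
      inv : ∀ α β → (∀ x → α (β x) ≡ x) → ∀ v → vertex (α (element (vertex (β (element v))))) ≡ v
      inv α β αβ v = trans (cong (vertex ∘ α) (element-vertex _)) (trans (cong vertex (αβ _)) (vertex-element v))
      σ-S′ : ∀ x y → connection (σ y // σ x) ≡ connection (y // x)
      σ-S′ x y with x ≟ y
      ... | yes refl = cong connection (trans (inverseʳ (σ x)) (sym (inverseʳ x)))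
      ... | no  x≢y  = σ-S x≢y
      σ̂-E : ∀ u v → E (σ̂ u) (σ̂ v) ≡ E u v
      σ̂-E u v = begin
        E (σ̂ u) (σ̂ v)                                        ≡⟨ E-connection _ _ ⟩
        connection (σ (element v) // σ (element u))          ≡⟨ σ-S′ (element u) (element v) ⟩
        connection (element v // element u)                  ≡⟨ sym (E-connection _ _) ⟩
        E (vertex (element u)) (vertex (element v))          ≡⟨ cong₂ E (vertex-element u) (vertex-element v) ⟩
        E u v                                                ∎
      σ̂-aut : IsDigraphAut (λ u v → E u v ≡ true) σ̂
      σ̂-aut = (τ̂ , inv τ σ τσ , inv σ τ στ) , λ u v → mk⇔ (trans (σ̂-E u v)) (trans (sym (σ̂-E u v)))
      σ̂-fix : σ̂ (vertex ε) ≡ vertex ε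
      σ̂-fix = cong vertex (trans (cong σ (element-vertex ε)) σε≡ε)

    connection-inverseClosed : IsGraph (λ u v → E u v ≡ true) → InverseClosed G connection
    connection-inverseClosed graph s Ss = graph _ _ (begin
      E (vertex (s ⁻¹)) v₀                      ≡⟨ cong₂ E refl (sym (trans (cong (λ g → ρ g v₀) ε⁻¹≈ε) (ρ-ε v₀))) ⟩
      E (vertex (s ⁻¹)) (vertex ε)              ≡⟨ E-connection (s ⁻¹) ε ⟩
      connection (ε // s ⁻¹)                    ≡⟨ cong connection (trans (identityˡ _) (⁻¹-involutive s)) ⟩
      connection s                              ≡⟨ Ss ⟩
      true                                      ∎)
      where open ≡-Reasoning

  trivial⇒rigid : (∀ x y → x ≡ y) → Rigid (λ _ → false)
  trivial⇒rigid all≡ _ _ _ = all≡ _ _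

  admitsDRR⇒rigid : AdmitsDRR G → ∃ Rigid
  admitsDRR⇒rigid (suc m , E , drr) = connection , connection-rigid
    where open Connection E drr zero
  -- Without vertices, injectivity of `ρ` makes the group trivial.
  admitsDRR⇒rigid (zero , E , _ , _ , _ , ρ-injective , _) =
    (λ _ → false) , trivial⇒rigid (λ x y → ρ-injective x y λ ())

  admitsGRR⇒rigid : AdmitsGRR G → ∃ λ S → InverseClosed G S × Rigid S
  admitsGRR⇒rigid (suc m , E , drr , graph) = connection , connection-inverseClosed graph , connection-rigid
    where open Connection E drr zero
  admitsGRR⇒rigid (zero , E , (_ , _ , _ , ρ-injective , _) , _) =
    (λ _ → false) , (λ _ ()) , trivial⇒rigid (λ x y → ρ-injective x y λ ())

-- Kernels and transport of rigidity.

module Homomorphism (G H : FinGroup) where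
  private
    module G = CayleyRigidity G
    module H = CayleyRigidity H

  module _ (h : G.C → H.C) (h-∙ : ∀ x y → h (x G.∙ y) ≡ h x H.∙ h y) where

    h-ε : h G.ε ≡ H.ε
    h-ε = H.x∙y≡x⇒y≡ε (trans (sym (h-∙ G.ε G.ε)) (cong h (G.identityˡ G.ε)))

    h-// : ∀ x y → h (y G.// x) ≡ h y H.// h x
    h-// x y = H.x≈z//y (h (y G.// x)) (h x) (h y)
      (trans (sym (h-∙ (y G.// x) x)) (cong h (G.//-rightDividesˡ x y)))

    kernel : G.Subgroup (λ x → h x ≡ H.ε)
    kernel = record
      { mem? = λ x → h x H.≟ H.ε
      ; ε∈   = h-ε
      ; ∙∈   = λ {x} {y} hx hy → trans (h-∙ x y) (trans (cong₂ H._∙_ hx hy) (H.identityˡ H.ε))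
      ; ⁻¹∈  = λ {x} hx → begin
          h (x G.⁻¹)          ≡⟨ cong h (sym (G.identityˡ (x G.⁻¹))) ⟩
          h (G.ε G.// x)      ≡⟨ h-// x G.ε ⟩
          h G.ε H.// h x      ≡⟨ cong₂ H._//_ h-ε hx ⟩
          H.ε H.// H.ε        ≡⟨ H.inverseʳ H.ε ⟩
          H.ε                 ∎ }
      where open ≡-Reasoning

  module Isomorphism (h : G.C → H.C) (h-∙ : ∀ x y → h (x G.∙ y) ≡ h x H.∙ h y)
    (k : H.C → G.C) (kh : ∀ x → k (h x) ≡ x) (hk : ∀ y → h (k y) ≡ y)
    {S : G.C → Bool} {T : H.C → Bool} (h-S : ∀ x → x ≢ G.ε → T (h x) ≡ S x) where

    rigid-transport : G.Rigid S → H.Rigid T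
    rigid-transport rigid {σ} ((τ , τσ , στ) , σ-T) σε≡ε y = begin
        σ y               ≡⟨ sym (hk (σ y)) ⟩
        h (k (σ y))       ≡⟨ cong (h ∘ k ∘ σ) (sym (hk y)) ⟩
        h (σ̂ (k y))       ≡⟨ cong h (rigid σ̂-aut σ̂ε≡ε (k y)) ⟩
        h (k y)           ≡⟨ hk y ⟩
        y                 ∎
      where
      open ≡-Reasoning
      σ̂ = k ∘ σ ∘ h
      τ̂ = k ∘ τ ∘ h
      τ̂σ̂ : ∀ x → τ̂ (σ̂ x) ≡ x
      τ̂σ̂ x = trans (cong (k ∘ τ) (hk _)) (trans (cong k (τσ _)) (kh x))
      σ̂τ̂ : ∀ x → σ̂ (τ̂ x) ≡ x
      σ̂τ̂ x = trans (cong (k ∘ σ) (hk _)) (trans (cong k (στ _)) (kh x))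
      T-S : ∀ {x y} → x ≢ y → T (h y H.// h x) ≡ S (y G.// x)
      T-S {x} {y} x≢y = trans (cong T (sym (h-// h h-∙ x y)))
        (h-S (y G.// x) (λ e → x≢y (sym (G.x∙y⁻¹≈ε⇒x≈y y x e))))
      σ̂-S : ∀ {x y} → x ≢ y → S (σ̂ y G.// σ̂ x) ≡ S (y G.// x)
      σ̂-S {x} {y} x≢y = begin
        S (σ̂ y G.// σ̂ x)             ≡⟨ sym (T-S (λ e → x≢y (trans (sym (τ̂σ̂ x)) (trans (cong τ̂ e) (τ̂σ̂ y))))) ⟩
        T (h (σ̂ y) H.// h (σ̂ x))     ≡⟨ cong₂ (λ a b → T (a H.// b)) (hk _) (hk _) ⟩
        T (σ (h y) H.// σ (h x))     ≡⟨ σ-T (λ e → x≢y (trans (sym (kh x)) (trans (cong k e) (kh y)))) ⟩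
        T (h y H.// h x)             ≡⟨ T-S x≢y ⟩
        S (y G.// x)                 ∎
      σ̂-aut : G.CayAut S σ̂
      σ̂-aut = (τ̂ , τ̂σ̂ , σ̂τ̂) , σ̂-S
      σ̂ε≡ε : σ̂ G.ε ≡ G.ε
      σ̂ε≡ε = trans (cong (k ∘ σ) (h-ε h h-∙)) (trans (cong k σε≡ε)
        (trans (cong k (sym (h-ε h h-∙))) (kh G.ε)))

-- Cartesian products of Cayley digraphs.

module Product (G₁ G₂ : FinGroup) where
  private
    module G₁ = CayleyRigidity G₁
    module G₂ = CayleyRigidity G₂
    module G  = CayleyRigidity (G₁ ×G G₂)

  infixr 6 _⊞_
  -- The connection set of the Cartesian product of the Cayley digraphs;
  -- its value at (ε , ε) is immaterial.
  _⊞_ : (G₁.C → Bool) → (G₂.C → Bool) → G.C → Bool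
  (S₁ ⊞ S₂) (a , b) with b G₂.≟ G₂.ε | a G₁.≟ G₁.ε
  ... | yes _ | _     = S₁ a
  ... | no _  | yes _ = S₂ b
  ... | no _  | no _  = false

  module _ (S₁ : G₁.C → Bool) (S₂ : G₂.C → Bool) where

    ⊞-left : ∀ a → (S₁ ⊞ S₂) (a , G₂.ε) ≡ S₁ a
    ⊞-left a with G₂.ε G₂.≟ G₂.ε | a G₁.≟ G₁.ε
    ... | yes _  | _ = refl
    ... | no ε≢ε | _ = contradiction refl ε≢ε

    ⊞-right : ∀ {b} → b ≢ G₂.ε → (S₁ ⊞ S₂) (G₁.ε , b) ≡ S₂ b
    ⊞-right {b} b≢ε with b G₂.≟ G₂.ε | G₁.ε G₁.≟ G₁.ε
    ... | yes b≡ε | _      = contradiction b≡ε b≢ε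
    ... | no _    | yes _  = refl
    ... | no _    | no ε≢ε = contradiction refl ε≢ε

    ⊞-mixed : ∀ {a b} → a ≢ G₁.ε → b ≢ G₂.ε → (S₁ ⊞ S₂) (a , b) ≡ false
    ⊞-mixed {a} {b} a≢ε b≢ε with b G₂.≟ G₂.ε | a G₁.≟ G₁.ε
    ... | yes b≡ε | _       = contradiction b≡ε b≢ε
    ... | no _    | yes a≡ε = contradiction a≡ε a≢ε
    ... | no _    | no _    = refl

    ⊞-support : ∀ x → (S₁ ⊞ S₂) x ≡ true → proj₂ x ≡ G₂.ε ⊎ proj₁ x ≡ G₁.ε
    ⊞-support (a , b) Sx with b G₂.≟ G₂.ε | a G₁.≟ G₁.ε
    ... | yes b≡ε | _       = inj₁ b≡ε
    ... | no _    | yes a≡ε = inj₂ a≡ε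

    ⊞-left′ : ∀ a {b} → b ≡ G₂.ε → (S₁ ⊞ S₂) (a , b) ≡ S₁ a
    ⊞-left′ a refl = ⊞-left a

    ⊞-inverseClosed : InverseClosed G₁ S₁ → InverseClosed G₂ S₂ → InverseClosed (G₁ ×G G₂) (S₁ ⊞ S₂)
    ⊞-inverseClosed closed₁ closed₂ (a , b) Sx = cases (b G₂.≟ G₂.ε) (⊞-support (a , b) Sx)
      where
      cases : Dec (b ≡ G₂.ε) → b ≡ G₂.ε ⊎ a ≡ G₁.ε → (S₁ ⊞ S₂) (a G₁.⁻¹ , b G₂.⁻¹) ≡ true
      cases (no b≢ε)   (inj₁ b≡ε)  = contradiction b≡ε b≢ε
      cases (yes refl) _           = trans (⊞-left′ (a G₁.⁻¹) G₂.ε⁻¹≈ε)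
        (closed₁ a (trans (sym (⊞-left a)) Sx))
      cases (no b≢ε)   (inj₂ refl) = trans (cong (λ c → (S₁ ⊞ S₂) (c , b G₂.⁻¹)) G₁.ε⁻¹≈ε)
        (trans (⊞-right (G₂.⁻¹-≢ε b≢ε)) (closed₂ b (trans (sym (⊞-right b≢ε)) Sx)))

    ⊞-cong₂ : ∀ a {b b′} → (b ≡ G₂.ε → b′ ≡ G₂.ε) → (b ≢ G₂.ε → b′ ≢ G₂.ε × S₂ b′ ≡ S₂ b) →
      (S₁ ⊞ S₂) (a , b′) ≡ (S₁ ⊞ S₂) (a , b)
    ⊞-cong₂ a {b} {b′} b≡ε⇒ b≢ε⇒ = cases (b G₂.≟ G₂.ε) (a G₁.≟ G₁.ε)
      where
      cases : Dec (b ≡ G₂.ε) → Dec (a ≡ G₁.ε) → (S₁ ⊞ S₂) (a , b′) ≡ (S₁ ⊞ S₂) (a , b)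
      cases (yes b≡ε) _          = trans (⊞-left′ a (b≡ε⇒ b≡ε)) (sym (⊞-left′ a b≡ε))
      cases (no b≢ε)  (yes refl) = trans (⊞-right (proj₁ (b≢ε⇒ b≢ε))) (trans (proj₂ (b≢ε⇒ b≢ε)) (sym (⊞-right b≢ε)))
      cases (no b≢ε)  (no a≢ε)   = trans (⊞-mixed a≢ε (proj₁ (b≢ε⇒ b≢ε))) (sym (⊞-mixed a≢ε b≢ε))

    extend-cayAut : ∀ {σ} → G₂.CayAut S₂ σ → G.CayAut (S₁ ⊞ S₂) (λ (a , b) → a , σ b)
    extend-cayAut {σ} ((τ , τσ , στ) , σ-S) =
      ((λ (a , b) → a , τ b) , (λ (a , b) → cong (a ,_) (τσ b)) , (λ (a , b) → cong (a ,_) (στ b)))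
      , λ { {a , b} {a′ , b′} _ → ⊞-cong₂ (a′ G₁.// a)
          (λ e → G₂.x≈y⇒x∙y⁻¹≈ε (cong σ (G₂.x∙y⁻¹≈ε⇒x≈y b′ b e)))
          (λ b′//b≢ε → (λ e → b′//b≢ε (G₂.x≈y⇒x∙y⁻¹≈ε (σ-injective (G₂.x∙y⁻¹≈ε⇒x≈y _ _ e))))
                     , σ-S (λ { refl → b′//b≢ε (G₂.inverseʳ b) })) }
      where
      σ-injective : ∀ {b b′} → σ b ≡ σ b′ → b ≡ b′
      σ-injective {b} {b′} e = trans (sym (τσ b)) (trans (cong τ e) (τσ b′))

    rigid-factor : G.Rigid (S₁ ⊞ S₂) → G₂.Rigid S₂
    rigid-factor rigid σ-aut σε≡ε b =
      cong proj₂ (rigid (extend-cayAut σ-aut) (cong (G₁.ε ,_) σε≡ε) (G₁.ε , b))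

  -- Automorphisms of the product and its two axes.

  module Axes (H : FinGroup) where
    private
      module H = CayleyRigidity H

    -- The preimages of the two axes under the injective `f` are commuting subgroups with trivial
    -- intersection that cover `S`. If both were proper, they would decompose `S`.
    in-axis : ∀ {S} → ¬ H.Decomposable S → (f : H.C → G.C) → (∀ x y → f (x H.∙ y) ≡ f x G.∙ f y) →
      (∀ {x} → f x ≡ G.ε → x ≡ H.ε) → (∀ x → x ≢ H.ε → S x ≡ true → proj₂ (f x) ≡ G₂.ε ⊎ proj₁ (f x) ≡ G₁.ε) →
      (∀ x → proj₂ (f x) ≡ G₂.ε) ⊎ (∀ x → proj₁ (f x) ≡ G₁.ε)
    in-axis {S} indec f f-∙ f-injective f-S
      with H.search (λ x → ¬? (proj₂ (f x) G₂.≟ G₂.ε)) | H.search (λ x → ¬? (proj₁ (f x) G₁.≟ G₁.ε))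
    ... | no none   | _         = inj₁ (λ x → decidable-stable (_ G₂.≟ _) (λ e → none (x , e)))
    ... | yes _     | no none   = inj₂ (λ x → decidable-stable (_ G₁.≟ _) (λ e → none (x , e)))
    ... | yes (x , x∉) | yes (y , y∉) = contradiction (_ , _ , pair , λ {x} → f-S x) indec
      where
      open ≡-Reasoning
      pair : H.ProperPair (λ x → proj₂ (f x) ≡ G₂.ε) (λ x → proj₁ (f x) ≡ G₁.ε)
      pair = record
        { subP = Homomorphism.kernel H G₂ (proj₂ ∘ f) (λ x y → cong proj₂ (f-∙ x y))
        ; subQ = Homomorphism.kernel H G₁ (proj₁ ∘ f) (λ x y → cong proj₁ (f-∙ x y))
        ; commute = λ {x} {y} x∈ y∈ → H.x∙y⁻¹≈ε⇒x≈y _ _ (f-injective (begin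
            f ((x H.∙ y) H.// (y H.∙ x))       ≡⟨ Homomorphism.h-// H (G₁ ×G G₂) f f-∙ (y H.∙ x) (x H.∙ y) ⟩
            f (x H.∙ y) G.// f (y H.∙ x)       ≡⟨ G.x≈y⇒x∙y⁻¹≈ε (begin
              f (x H.∙ y)                      ≡⟨ f-∙ x y ⟩
              f x G.∙ f y                      ≡⟨ cong₂ _,_
                (trans (cong (proj₁ (f x) G₁.∙_) y∈) (trans (G₁.identityʳ _)
                  (sym (trans (cong (G₁._∙ proj₁ (f x)) y∈) (G₁.identityˡ _)))))
                (trans (cong (G₂._∙ proj₂ (f y)) x∈) (trans (G₂.identityˡ _)
                  (sym (trans (cong (proj₂ (f y) G₂.∙_) x∈) (G₂.identityʳ _))))) ⟩
              f y G.∙ f x                      ≡⟨ sym (f-∙ y x) ⟩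
              f (y H.∙ x)                      ∎) ⟩
            G.ε                                ∎))
        ; disjoint = λ x∈ x∈′ → f-injective (cong₂ _,_ x∈′ x∈)
        ; properP = x , x∉
        ; properQ = y , y∉ }

  module Rigidity {S₁ S₂} (rigid₁ : G₁.Rigid S₁) (autS₂ : G₂.AutTrivial S₂)
    (indec₁ : ¬ G₁.Decomposable S₁) (indec₂ : ¬ G₂.Decomposable S₂) (¬rigid₂ : ¬ G₂.Rigid S₂)
    (φ : G.C → G.C) (φ-aut : IsGroupAut (G₁ ×G G₂) φ)
    (φ-S : ∀ x → x ≢ G.ε → (S₁ ⊞ S₂) (φ x) ≡ (S₁ ⊞ S₂) x) where

    φ-∙ = proj₁ φ-aut
    ψ   = proj₁ (proj₂ φ-aut)
    ψφ  = proj₁ (proj₂ (proj₂ φ-aut))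
    φψ  = proj₂ (proj₂ (proj₂ φ-aut))

    ι₁ : G₁.C → G.C
    ι₁ a = a , G₂.ε
    ι₂ : G₂.C → G.C
    ι₂ b = G₁.ε , b

    φι₁-∙ : ∀ x y → φ (ι₁ (x G₁.∙ y)) ≡ φ (ι₁ x) G.∙ φ (ι₁ y)
    φι₁-∙ x y = trans (cong φ (cong (x G₁.∙ y ,_) (sym (G₂.identityˡ G₂.ε)))) (φ-∙ (ι₁ x) (ι₁ y))

    φι₂-∙ : ∀ x y → φ (ι₂ (x G₂.∙ y)) ≡ φ (ι₂ x) G.∙ φ (ι₂ y)
    φι₂-∙ x y = trans (cong φ (cong (_, x G₂.∙ y) (sym (G₁.identityˡ G₁.ε)))) (φ-∙ (ι₂ x) (ι₂ y))

    φ-kernel : ∀ {x} → φ x ≡ G.ε → x ≡ G.ε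
    φ-kernel {x} e = trans (sym (ψφ x)) (trans (cong ψ (trans e (sym (G.group-aut-ε φ-aut)))) (ψφ G.ε))

    φ-split : ∀ a b → φ (a , b) ≡ φ (ι₁ a) G.∙ φ (ι₂ b)
    φ-split a b = trans (cong φ (cong₂ _,_ (sym (G₁.identityʳ a)) (sym (G₂.identityˡ b)))) (φ-∙ (ι₁ a) (ι₂ b))

    axis₁ : (∀ a → proj₂ (φ (ι₁ a)) ≡ G₂.ε) ⊎ (∀ a → proj₁ (φ (ι₁ a)) ≡ G₁.ε)
    axis₁ = Axes.in-axis G₁ indec₁ (φ ∘ ι₁) φι₁-∙ (cong proj₁ ∘ φ-kernel) (λ a a≢ε Sa →
      ⊞-support S₁ S₂ _ (trans (φ-S (ι₁ a) (a≢ε ∘ cong proj₁)) (trans (⊞-left S₁ S₂ a) Sa)))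

    axis₂ : (∀ b → proj₂ (φ (ι₂ b)) ≡ G₂.ε) ⊎ (∀ b → proj₁ (φ (ι₂ b)) ≡ G₁.ε)
    axis₂ = Axes.in-axis G₂ indec₂ (φ ∘ ι₂) φι₂-∙ (cong proj₂ ∘ φ-kernel) (λ b b≢ε Sb →
      ⊞-support S₁ S₂ _ (trans (φ-S (ι₂ b) (b≢ε ∘ cong proj₂)) (trans (⊞-right S₁ S₂ b≢ε) Sb)))

    diagonal : (∀ a → proj₂ (φ (ι₁ a)) ≡ G₂.ε) → (∀ b → proj₁ (φ (ι₂ b)) ≡ G₁.ε) → ∀ x → φ x ≡ x
    diagonal φι₁ φι₂ (a , b) = trans (φ≡ a b) (cong₂ _,_ (φ₁≡id a) (φ₂≡id b))
      where
      open ≡-Reasoning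
      φ₁ = proj₁ ∘ φ ∘ ι₁
      φ₂ = proj₂ ∘ φ ∘ ι₂
      φ≡ : ∀ a b → φ (a , b) ≡ (φ₁ a , φ₂ b)
      φ≡ a b = trans (φ-split a b) (cong₂ _,_
        (trans (cong (φ₁ a G₁.∙_) (φι₂ b)) (G₁.identityʳ (φ₁ a)))
        (trans (cong (G₂._∙ φ₂ b) (φι₁ a)) (G₂.identityˡ (φ₂ b))))
      φι₁≡ : ∀ a → φ (ι₁ a) ≡ ι₁ (φ₁ a)
      φι₁≡ a = cong (φ₁ a ,_) (φι₁ a)
      φι₂≡ : ∀ b → φ (ι₂ b) ≡ ι₂ (φ₂ b)
      φι₂≡ b = cong (_, φ₂ b) (φι₂ b)
      φψ-components : ∀ x → φ₁ (proj₁ (ψ x)) ≡ proj₁ x × φ₂ (proj₂ (ψ x)) ≡ proj₂ x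
      φψ-components x = cong proj₁ e , cong proj₂ e where e = trans (sym (φ≡ _ _)) (φψ x)
      φ₁-aut : IsGroupAut G₁ φ₁
      φ₁-aut = (λ x y → cong proj₁ (φι₁-∙ x y)) , proj₁ ∘ ψ ∘ ι₁
             , (λ a → cong proj₁ (trans (cong ψ (sym (φι₁≡ a))) (ψφ (ι₁ a))))
             , (λ a → proj₁ (φψ-components (ι₁ a)))
      φ₂-aut : IsGroupAut G₂ φ₂
      φ₂-aut = (λ x y → cong proj₂ (φι₂-∙ x y)) , proj₂ ∘ ψ ∘ ι₂
             , (λ b → cong proj₂ (trans (cong ψ (sym (φι₂≡ b))) (ψφ (ι₂ b))))
             , (λ b → proj₂ (φψ-components (ι₂ b)))
      φ₁-S : ∀ a → a ≢ G₁.ε → S₁ (φ₁ a) ≡ S₁ a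
      φ₁-S a a≢ε = begin
        S₁ (φ₁ a)                ≡⟨ sym (⊞-left S₁ S₂ (φ₁ a)) ⟩
        (S₁ ⊞ S₂) (ι₁ (φ₁ a))    ≡⟨ cong (S₁ ⊞ S₂) (sym (φι₁≡ a)) ⟩
        (S₁ ⊞ S₂) (φ (ι₁ a))     ≡⟨ φ-S (ι₁ a) (a≢ε ∘ cong proj₁) ⟩
        (S₁ ⊞ S₂) (ι₁ a)         ≡⟨ ⊞-left S₁ S₂ a ⟩
        S₁ a                     ∎
      φ₂-S : ∀ b → b ≢ G₂.ε → S₂ (φ₂ b) ≡ S₂ b
      φ₂-S b b≢ε = begin
        S₂ (φ₂ b)                ≡⟨ sym (⊞-right S₁ S₂ φ₂b≢ε) ⟩
        (S₁ ⊞ S₂) (ι₂ (φ₂ b))    ≡⟨ cong (S₁ ⊞ S₂) (sym (φι₂≡ b)) ⟩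
        (S₁ ⊞ S₂) (φ (ι₂ b))     ≡⟨ φ-S (ι₂ b) (b≢ε ∘ cong proj₂) ⟩
        (S₁ ⊞ S₂) (ι₂ b)         ≡⟨ ⊞-right S₁ S₂ b≢ε ⟩
        S₂ b                     ∎
        where
        φ₂b≢ε : φ₂ b ≢ G₂.ε
        φ₂b≢ε e = b≢ε (cong proj₂ (φ-kernel (trans (φι₂≡ b) (cong ι₂ e))))
      φ₁≡id : ∀ a → φ₁ a ≡ a
      φ₁≡id = G₁.rigid⇒autTrivial rigid₁ φ₁ φ₁-aut φ₁-S
      φ₂≡id : ∀ b → φ₂ b ≡ b
      φ₂≡id = autS₂ φ₂ φ₂-aut φ₂-S

    -- When `φ` swaps the axes, it induces an isomorphism `h` that carries `S₁` to `S₂` off the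
    -- identity, and rigidity is transported along it.
    antidiagonal : (∀ a → proj₁ (φ (ι₁ a)) ≡ G₁.ε) → (∀ b → proj₂ (φ (ι₂ b)) ≡ G₂.ε) → G₂.Rigid S₂
    antidiagonal φι₁ φι₂ = Homomorphism.Isomorphism.rigid-transport G₁ G₂ h h-∙ k kh hk {S₁} {S₂} h-S rigid₁
      where
      open ≡-Reasoning
      h = proj₂ ∘ φ ∘ ι₁
      k = proj₁ ∘ ψ ∘ ι₂
      h-∙ : ∀ x y → h (x G₁.∙ y) ≡ h x G₂.∙ h y
      h-∙ x y = cong proj₂ (φι₁-∙ x y)
      φι₁≡ : ∀ a → φ (ι₁ a) ≡ ι₂ (h a)
      φι₁≡ a = cong (_, h a) (φι₁ a)
      kh : ∀ a → k (h a) ≡ a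
      kh a = cong proj₁ (trans (cong ψ (sym (φι₁≡ a))) (ψφ (ι₁ a)))
      hk : ∀ b → h (k b) ≡ b
      hk b = begin
        h (k b)                                      ≡⟨ sym (G₂.identityʳ _) ⟩
        h (k b) G₂.∙ G₂.ε                            ≡⟨ cong (h (k b) G₂.∙_) (sym (φι₂ _)) ⟩
        proj₂ (φ (ι₁ (k b)) G.∙ φ (ι₂ (proj₂ (ψ (ι₂ b))))) ≡⟨ cong proj₂ (sym (φ-split _ _)) ⟩
        proj₂ (φ (ψ (ι₂ b)))                         ≡⟨ cong proj₂ (φψ (ι₂ b)) ⟩
        b                                            ∎
      h-S : ∀ a → a ≢ G₁.ε → S₂ (h a) ≡ S₁ a
      h-S a a≢ε = begin
        S₂ (h a)                ≡⟨ sym (⊞-right S₁ S₂ ha≢ε) ⟩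
        (S₁ ⊞ S₂) (ι₂ (h a))    ≡⟨ cong (S₁ ⊞ S₂) (sym (φι₁≡ a)) ⟩
        (S₁ ⊞ S₂) (φ (ι₁ a))    ≡⟨ φ-S (ι₁ a) (a≢ε ∘ cong proj₁) ⟩
        (S₁ ⊞ S₂) (ι₁ a)        ≡⟨ ⊞-left S₁ S₂ a ⟩
        S₁ a                    ∎
        where
        ha≢ε : h a ≢ G₂.ε
        ha≢ε e = a≢ε (cong proj₁ (φ-kernel (trans (φι₁≡ a) (cong ι₂ e))))

    trivial₂ : (∀ a → proj₂ (φ (ι₁ a)) ≡ G₂.ε) → (∀ b → proj₂ (φ (ι₂ b)) ≡ G₂.ε) → ∀ b → b ≡ G₂.ε
    trivial₂ φι₁ φι₂ b = trans (sym (cong proj₂ (trans (sym (φ-split _ _)) (φψ (ι₂ b)))))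
      (trans (cong₂ G₂._∙_ (φι₁ _) (φι₂ _)) (G₂.identityˡ G₂.ε))

    trivial₁ : (∀ a → proj₁ (φ (ι₁ a)) ≡ G₁.ε) → (∀ b → proj₁ (φ (ι₂ b)) ≡ G₁.ε) → ∀ a → a ≡ G₁.ε
    trivial₁ φι₁ φι₂ a = trans (sym (cong proj₁ (trans (sym (φ-split _ _)) (φψ (ι₁ a)))))
      (trans (cong₂ G₁._∙_ (φι₁ _) (φι₂ _)) (G₁.identityˡ G₁.ε))

    φ≡id : ∀ x → φ x ≡ x
    φ≡id with axis₁ | axis₂
    ... | inj₁ φι₁ | inj₂ φι₂ = diagonal φι₁ φι₂
    ... | inj₂ φι₁ | inj₁ φι₂ = contradiction (λ {σ} → antidiagonal φι₁ φι₂ {σ}) ¬rigid₂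
    -- With everything mapped into the first axis, surjectivity makes the second group trivial and
    -- `S₂` rigid.
    ... | inj₁ φι₁ | inj₁ φι₂ = contradiction (λ {σ} → rigid₂ {σ}) ¬rigid₂
      where
      rigid₂ : G₂.Rigid S₂
      rigid₂ _ _ b = trans (trivial₂ φι₁ φι₂ _) (sym (trivial₂ φι₁ φι₂ b))
    -- Here the first group is trivial, so its axis is preserved after all.
    ... | inj₂ φι₁ | inj₂ φι₂ = diagonal
      (λ a → cong proj₂ (trans (cong (φ ∘ ι₁) (trivial₁ φι₁ φι₂ a)) (G.group-aut-ε φ-aut))) φι₂

  ⊞-autTrivial : ∀ {S₁ S₂} → G₁.Rigid S₁ → G₂.AutTrivial S₂ → ¬ G₁.Decomposable S₁ → ¬ G₂.Decomposable S₂ →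
    ¬ G₂.Rigid S₂ → G.AutTrivial (S₁ ⊞ S₂)
  ⊞-autTrivial {S₁} {S₂} rigid₁ autS₂ indec₁ indec₂ ¬rigid₂ =
    Rigidity.φ≡id {S₁} {S₂} rigid₁ autS₂ indec₁ indec₂ ¬rigid₂

  -- Detection is assumed for all choices of complements, because which of them are indecomposable
  -- is known only up to double negation. The goal `σ x ≡ x` is decidable, so a contradiction from
  -- its negation suffices.
  rigid-descends : ∀ {S₁ S₂} → G₁.Rigid S₁ → G₂.AutTrivial S₂ →
    (∀ b₁ b₂ → let S = ((b₁ xor_) ∘ S₁) ⊞ ((b₂ xor_) ∘ S₂) in G.AutTrivial S → G.Rigid S) →
    G₂.Rigid S₂
  rigid-descends {S₁} {S₂} rigid₁ autS₂ detect {σ} σ-aut σε≡ε x = decidable-stable (σ x G₂.≟ x) λ σx≢x →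
    G₁.some-indecomposable {S₁} (G₁.rigid⇒autTrivial rigid₁) λ b₁ indec₁ →
    G₂.some-indecomposable {S₂} autS₂ λ b₂ indec₂ →
    let S₁′ = (b₁ xor_) ∘ S₁
        S₂′ = (b₂ xor_) ∘ S₂
        -- The given `σ` is also an automorphism for the complement of `S₂`, and it moves `x`.
        ¬rigid₂ = λ (rigid : G₂.Rigid S₂′) → σx≢x (rigid (G₂.cayAut-xor b₂ {S₂} σ-aut) σε≡ε x)
    in ¬rigid₂ (rigid-factor S₁′ S₂′ (detect b₁ b₂ (⊞-autTrivial {S₁′} {S₂′}
         (G₁.rigid-xor b₁ {S₁} rigid₁) (G₂.autTrivial-xor b₂ {S₂} autS₂) indec₁ indec₂ ¬rigid₂)))

theorem1p9 : (G₁ G₂ : FinGroup) →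
    (AdmitsDRR G₁ → ¬ DRRDetecting G₂ → ¬ DRRDetecting (G₁ ×G G₂))
    × (AdmitsGRR G₁ → ¬ GRRDetecting G₂ → ¬ GRRDetecting (G₁ ×G G₂))
theorem1p9 G₁ G₂ = drr , grr
  where
  module G₁ = CayleyRigidity G₁
  module G₂ = CayleyRigidity G₂
  module G  = CayleyRigidity (G₁ ×G G₂)
  open Product G₁ G₂

  drr : AdmitsDRR G₁ → ¬ DRRDetecting G₂ → ¬ DRRDetecting (G₁ ×G G₂)
  drr admits ¬detecting detecting with G₁.admitsDRR⇒rigid admits
  -- By contraposition: detection for the product yields detection for the second factor.
  ... | S₁ , rigid₁ = ¬detecting λ S₂ autS₂ → G₂.rigid⇒isDRR {S₂} (rigid-descends {S₁} {S₂} rigid₁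
    (G₂.autGSTrivial⇒autTrivial {S₂} autS₂)
    (λ b₁ b₂ autS → G.isDRR⇒rigid (detecting _ (G.autTrivial⇒autGSTrivial autS))))

  grr : AdmitsGRR G₁ → ¬ GRRDetecting G₂ → ¬ GRRDetecting (G₁ ×G G₂)
  grr admits ¬detecting detecting with G₁.admitsGRR⇒rigid admits
  ... | S₁ , closed₁ , rigid₁ = ¬detecting λ S₂ closed₂ autS₂ →
    G₂.rigid⇒isDRR {S₂} (rigid-descends {S₁} {S₂} rigid₁
      (G₂.autGSTrivial⇒autTrivial {S₂} autS₂)
      (λ b₁ b₂ autS → G.isDRR⇒rigid (proj₁ (detecting _
        (⊞-inverseClosed _ _ (G₁.inverseClosed-xor b₁ closed₁) (G₂.inverseClosed-xor b₂ closed₂))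
        (G.autTrivial⇒autGSTrivial autS)))))
    , G₂.inverseClosed⇒isGraph {S₂} closed₂
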